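{- Let $(U_n)_{n\in\mathbb N}$ be a sequence of subsets of $\mathbb N$ and put $U=U_0$. Suppose that: (i) $(U_n)$ is a weak dyadic tower, i.e. $U_n\equiv_1 2U_{n+1}$ for every $n\in\mathbb N$; (ii) $U$ is not a cylinder; (iii) $U$ has computable reservoirs of both colours; (iv) $(U,(U_n))$ has the base absorption property, i.e. for every $X\leq_1U$ there are $n\in\mathbb N$ and $m\geq1$ such that $U\oplus X\equiv_1 mU_n$. Then every $B\subseteq\mathbb N$ with $B\equiv_{\mathrm{bfo}}U$ is one-one equivalent to $mU_n$ for some $m\geq1$ and $n\in\mathbb N$. Consequently, \[ \left(\{[B]_1:B\equiv_{\mathrm{bfo}}U\},\leq_1\right)\cong(\mathbb D_{>0},\leq) \] as partially ordered sets, where $\mathbb D_{>0}=\{m/2^n:m\geq1,\ n\in\mathbb N\}$ is the set of positive dyadic rationals with the usual order.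
   Context: All sets are subsets of $\mathbb N=\{0,1,2,\ldots\}$. A total computable $f:\mathbb N\to\mathbb N$ is a many-one reduction from $A$ to $B$ if $x\in A\iff f(x)\in B$ for all $x$. It is a one-one reduction if injective, and a bounded finite-one reduction if there is a constant $k\geq1$ with $|f^{ -1}(y)|\leq k$ for all $y$. Write $\leq_1$, $\leq_{\mathrm{bfo}}$ for the corresponding reducibilities and $\equiv_1$, $\equiv_{\mathrm{bfo}}$ for the induced equivalences; $[B]_1$ is the $\equiv_1$-class of $B$, and $\leq_1$ induces a partial order on these classes. For each $m\geq1$ fix a computable bijection $\langle\cdot,\cdot\rangle_m:\{0,\ldots,m-1\}\times\mathbb N\to\mathbb N$ with computable inverse, and fix a computable bijection $\langle\cdot,\cdot\rangle:\mathbb N\times\mathbb N\to\mathbb N$. The $m$-fold autojoin is $mA=\{\langle i,x\rangle_m:i<m,\ x\in A\}$; the binary join is $A\oplus B=\{\langle0,x\rangle_2:x\in A\}\cup\{\langle1,x\rangle_2:x\in B\}$. The cylinder over $A$ is $\mathrm{Cyl}(A)=\{\langle x,t\rangle:x\in A,\ t\in\mathbb N\}$; $A$ is a cylinder if $A\equiv_1\mathrm{Cyl}(A)$. $A$ has computable reservoirs of both colours if there are computable infinite sets $R_1\subseteq A$ and $R_0\subseteq\mathbb N\setminus A$. No uniform procedure producing indices of the equivalences in the definition of a weak dyadic tower is assumed. -}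

module Defs where

open import Data.Fin.Base using (Fin; toℕ; zero; suc)
open import Data.Integer.Base using (+_)
open import Data.List.Base using (List; length)
open import Data.List.Relation.Unary.All using (All)
open import Data.List.Relation.Unary.Unique.Propositional using (Unique)
open import Data.Nat.Base using (ℕ; zero; suc; _≤_; _<_; _^_; NonZero)
open import Data.Nat.Properties using (m^n≢0)
open import Data.Product.Base
  using (Σ; Σ-syntax; ∃; ∃-syntax; ∃₂; _×_; _,_; proj₁; proj₂; swap)
open import Data.Rational.Base using (ℚ; _/_)
open import Data.Rational.Properties using () renaming (≤-isPartialOrder to ℚ-≤-isPartialOrder)
open import Data.Sum.Base using (_⊎_)
open import Data.Vec.Base using (Vec; []; _∷_; lookup)
open import Data.Vec.Relation.Binary.Pointwise.Inductive using (Pointwise; []; _∷_)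
open import Function.Base using (id; _∘_)
open import Function.Bundles using (_⇔_; _↔_; _⤖_; Inverse; Bijection)
open import Function.Construct.Composition using (_⇔-∘_)
open import Function.Construct.Identity using (⇔-id)
open import Function.Definitions using (Injective)
open import Level using (0ℓ; _⊔_) renaming (suc to lsuc)
open import Relation.Binary.Bundles using (Poset)
import Relation.Binary.Construct.On as On
open import Relation.Binary.Morphism.Structures using (IsOrderIsomorphism)
open import Relation.Binary.PropositionalEquality using (_≡_; refl)
open import Relation.Nullary using (¬_)
open import Relation.Unary using (Pred; _∈_; _∉_; _⊆_; ∁)

private
  variable
    k n : ℕ

-- Codes for the n-ary partial recursive functions; prec recurses on, and mu
-- minimises over, the first argument.

data Rec : ℕ → Set where
  zer  : Rec 0
  succ : Rec 1
  proj : Fin n → Rec n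
  comp : Rec k → Vec (Rec n) k → Rec n
  prec : Rec n → Rec (suc (suc n)) → Rec (suc n)
  mu   : Rec (suc n) → Rec n

infix 4 _[_]⇓_

data _[_]⇓_ : Rec n → Vec ℕ n → ℕ → Set where
  zer⇓  : zer [ [] ]⇓ 0
  succ⇓ : ∀ {x} → succ [ x ∷ [] ]⇓ suc x
  proj⇓ : ∀ {v : Vec ℕ n} (i : Fin n) → proj i [ v ]⇓ lookup v i
  comp⇓ : ∀ {h : Rec k} {gs : Vec (Rec n) k} {v ys z} →
          Pointwise (λ g y → g [ v ]⇓ y) gs ys → h [ ys ]⇓ z →
          comp h gs [ v ]⇓ z
  prec⇓-zero : ∀ {g : Rec n} {h v y} →
          g [ v ]⇓ y → prec g h [ zero ∷ v ]⇓ y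
  prec⇓-suc  : ∀ {g : Rec n} {h v x y z} →
          prec g h [ x ∷ v ]⇓ y → h [ x ∷ y ∷ v ]⇓ z →
          prec g h [ suc x ∷ v ]⇓ z
  mu⇓   : ∀ {f : Rec (suc n)} {v y} →
          (∀ i → i < y → ∃[ z ] f [ i ∷ v ]⇓ suc z) → f [ y ∷ v ]⇓ 0 →
          mu f [ v ]⇓ y

Computable : (ℕ → ℕ) → Set
Computable f = ∃[ c ] ∀ x → c [ x ∷ [] ]⇓ f x

Computable₂ : (ℕ × ℕ → ℕ) → Set
Computable₂ f = ∃[ c ] ∀ x y → c [ x ∷ y ∷ [] ]⇓ f (x , y)

-- For functions on {0,…,m-1} × ℕ; nothing is asked of the code at
-- arguments whose first component is ≥ m.
ComputableFin : ∀ {m} → (Fin m × ℕ → ℕ) → Set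
ComputableFin f = ∃[ c ] ∀ i x → c [ toℕ i ∷ x ∷ [] ]⇓ f (i , x)

record IsManyOneReduction (A B : Pred ℕ 0ℓ) (f : ℕ → ℕ) : Set where
  field
    computable : Computable f
    reduces    : ∀ x → x ∈ A ⇔ f x ∈ B

-- |f⁻¹(y)| ≤ b for all y: no b + 1 distinct numbers share a value.
FibresBoundedBy : ℕ → (ℕ → ℕ) → Set
FibresBoundedBy b f =
  ∀ y (xs : List ℕ) → Unique xs → All (λ x → f x ≡ y) xs → length xs ≤ b

infix 4 _≤₁_ _≡₁_ _≤bfo_ _≡bfo_

_≤₁_ _≡₁_ _≤bfo_ _≡bfo_ : Pred ℕ 0ℓ → Pred ℕ 0ℓ → Set
A ≤₁ B   = ∃[ f ] IsManyOneReduction A B f × Injective _≡_ _≡_ f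
A ≡₁ B   = A ≤₁ B × B ≤₁ A
A ≤bfo B = ∃[ f ] IsManyOneReduction A B f ×
                  ∃[ b ] 1 ≤ b × FibresBoundedBy b f
A ≡bfo B = A ≤bfo B × B ≤bfo A

≤₁-refl : ∀ {A} → A ≤₁ A
≤₁-refl = id
  , record { computable = proj zero , λ x → proj⇓ zero ; reduces = λ x → ⇔-id _ }
  , id

≤₁-trans : ∀ {A B C} → A ≤₁ B → B ≤₁ C → A ≤₁ C
≤₁-trans (f , F , f-inj) (g , G , g-inj) =
  g ∘ f
  , record
    { computable = comp (proj₁ G.computable) (proj₁ F.computable ∷ [])
                 , λ x → comp⇓ (proj₂ F.computable x ∷ [])
                               (proj₂ G.computable (f x))
    ; reduces    = λ x → G.reduces (f x) ⇔-∘ F.reduces x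
    }
  , f-inj ∘ g-inj
  where
  module F = IsManyOneReduction F
  module G = IsManyOneReduction G

-- A 1-degree [B]₁ is represented by any of its members B, with _≡₁_ as equality.
≤₁-poset : Poset (lsuc 0ℓ) 0ℓ 0ℓ
≤₁-poset = record
  { Carrier        = Pred ℕ 0ℓ
  ; _≈_            = _≡₁_
  ; _≤_            = _≤₁_
  ; isPartialOrder = record
    { isPreorder = record
      { isEquivalence = record
        { refl  = ≤₁-refl , ≤₁-refl
        ; sym   = swap
        ; trans = λ { (p , q) (r , s) → ≤₁-trans p r , ≤₁-trans s q }
        }
      ; reflexive = proj₁
      ; trans     = ≤₁-trans
      }
    ; antisym = _,_
    }
  }

OneDegreesWithinBfo : Pred ℕ 0ℓ → Poset (lsuc 0ℓ) 0ℓ 0ℓ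
OneDegreesWithinBfo A = On.poset ≤₁-poset (proj₁ {B = _≡bfo A})

ComputableSet : Pred ℕ 0ℓ → Set
ComputableSet R =
  ∃[ χ ] Computable χ × ∀ x → (x ∈ R × χ x ≡ 1) ⊎ (x ∉ R × χ x ≡ 0)

Infinite : Pred ℕ 0ℓ → Set
Infinite R = ∀ b → ∃[ x ] b ≤ x × x ∈ R

HasComputableReservoirs : Pred ℕ 0ℓ → Set₁
HasComputableReservoirs A =
  (∃[ R₁ ] ComputableSet R₁ × Infinite R₁ × R₁ ⊆ A) ×
  (∃[ R₀ ] ComputableSet R₀ × Infinite R₀ × R₀ ⊆ ∁ A)

record Pairings : Set where
  field
    -- ⟨_,_⟩ₘ for each m ≥ 1; no uniformity in m is required.
    finPairing            : ∀ m .{{_ : NonZero m}} → (Fin m × ℕ) ↔ ℕ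
    finPairing-computable : ∀ m .{{_ : NonZero m}} →
      ComputableFin (Inverse.to (finPairing m))
    finPairing⁻¹-computable : ∀ m .{{_ : NonZero m}} →
      Computable (toℕ ∘ proj₁ ∘ Inverse.from (finPairing m)) ×
      Computable (proj₂ ∘ Inverse.from (finPairing m))
    pairing               : (ℕ × ℕ) ⤖ ℕ
    pairing-computable    : Computable₂ (Bijection.to pairing)

  ⟨_,_⟩ᶠ : ∀ {m} .{{_ : NonZero m}} → Fin m → ℕ → ℕ
  ⟨_,_⟩ᶠ {m} i x = Inverse.to (finPairing m) (i , x)

  ⟨_,_⟩ : ℕ → ℕ → ℕ
  ⟨ x , t ⟩ = Bijection.to pairing (x , t)

module Joins (P : Pairings) where
  open Pairings P

  autojoin : ∀ m .{{_ : NonZero m}} → Pred ℕ 0ℓ → Pred ℕ 0ℓ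
  autojoin m A y = ∃₂ λ (i : Fin m) x → x ∈ A × y ≡ ⟨ i , x ⟩ᶠ

  infixr 6 _⊕_

  _⊕_ : Pred ℕ 0ℓ → Pred ℕ 0ℓ → Pred ℕ 0ℓ
  (A ⊕ B) y =
    (∃[ x ] x ∈ A × y ≡ ⟨ zero {1} , x ⟩ᶠ) ⊎
    (∃[ x ] x ∈ B × y ≡ ⟨ suc {1} zero , x ⟩ᶠ)

  Cyl : Pred ℕ 0ℓ → Pred ℕ 0ℓ
  Cyl A y = ∃₂ λ x t → x ∈ A × y ≡ ⟨ x , t ⟩

  IsCylinder : Pred ℕ 0ℓ → Set
  IsCylinder A = A ≡₁ Cyl A

  WeakDyadicTower : (ℕ → Pred ℕ 0ℓ) → Set
  WeakDyadicTower U = ∀ n → U n ≡₁ autojoin 2 (U (suc n))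

  IsAutojoinOfMember : (ℕ → Pred ℕ 0ℓ) → Pred ℕ 0ℓ → Set
  IsAutojoinOfMember U B =
    ∃₂ λ m n → Σ[ m≢0 ∈ NonZero m ] B ≡₁ autojoin m {{m≢0}} (U n)

  BaseAbsorption : Pred ℕ 0ℓ → (ℕ → Pred ℕ 0ℓ) → Set₁
  BaseAbsorption A U = ∀ X → X ≤₁ A → IsAutojoinOfMember U (A ⊕ X)

IsPositiveDyadic : Pred ℚ 0ℓ
IsPositiveDyadic q =
  ∃₂ λ m n → NonZero m × q ≡ _/_ (+ m) (2 ^ n) {{m^n≢0 2 n}}

𝔻>0 : Poset 0ℓ 0ℓ 0ℓ
𝔻>0 = On.poset (record { isPartialOrder = ℚ-≤-isPartialOrder })
                (proj₁ {B = IsPositiveDyadic})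

infix 4 _≅_

_≅_ : ∀ {a ℓ₁ ℓ₂ b ℓ₃ ℓ₄} → Poset a ℓ₁ ℓ₂ → Poset b ℓ₃ ℓ₄ →
      Set (a ⊔ ℓ₁ ⊔ ℓ₂ ⊔ b ⊔ ℓ₃ ⊔ ℓ₄)
P ≅ Q = ∃[ f ] IsOrderIsomorphism P._≈_ Q._≈_ P._≤_ Q._≤_ f
  where
  module P = Poset P
  module Q = Poset Q

{-# OPTIONS --safe #-}
module Submission where

-- Everything rests on a greedy matching principle: process the points of A one
-- after the other and send each to a free value of the right colour, found by
-- following an injective walk whose states offer candidate values with bounded
-- multiplicity. Such a walk cannot stay among the finitely many occupied values,
-- so it stops. This yields
--   * cancellation: A ⊕ C ≤₁ B ⊕ C and C ≤bfo B imply A ≤₁ B;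
--   * Hilbert's hotel: C ⊕ E ≤₁ C, C ≤bfo U and U ≤bfo E make U a cylinder,
--     so m Uₙ ≤₁ m′ Uₙ forces m ≤ m′ when U is not a cylinder.
-- If f : B ≤bfo U, then B is the disjoint union of finitely many sets on which f
-- is injective, the points of B of rank j in their fibre. Each of these is
-- ≤₁ U ⊕ ∅ ≤₁ U, the last step using the reservoir R₀. Adding them one at a time,
-- base absorption and cancellation of the extra copy of U keep U ⊕ (union) of the
-- form m Uₙ; finally U itself is cancelled from B ⊕ U.

open import Defs
open import Data.Empty using (⊥)
open import Data.Fin.Base using (Fin; zero; suc; toℕ)
import Data.Fin.Base as Fin using (_↑ˡ_; _↑ʳ_; splitAt; join; combine; remQuot)
import Data.Fin.Properties as Fin
import Data.Integer.Base as ℤ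
import Data.Integer.Properties as ℤ
open import Data.List.Base as List using (List; []; _∷_; length; filter; applyUpTo)
open import Data.List.Properties using (length-applyUpTo; length-map)
open import Data.List.Relation.Unary.All as All using (All)
import Data.List.Relation.Unary.All.Properties as All
open import Data.List.Relation.Unary.Unique.Propositional using (Unique)
import Data.List.Relation.Unary.AllPairs as AllPairs
import Data.List.Relation.Unary.Unique.Propositional.Properties as Unique
open import Data.Nat.Base hiding (_/_)
open import Data.Nat.Induction using (<-rec)
open import Data.Nat.Properties
open import Data.Product.Base using (Σ-syntax; ∃-syntax; _×_; _,_; proj₁; proj₂; uncurry)
open import Data.Rational.Base as ℚ using (_/_)
import Data.Rational.Properties as ℚ
open import Data.Rational.Unnormalised.Base using (ℚᵘ; mkℚᵘ; *≤*)
import Data.Rational.Unnormalised.Properties as ℚᵘ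
open import Data.Vec.Base using (Vec; []; _∷_; lookup; map; allFin)
open import Data.Vec.Properties using (map-lookup-allFin)
open import Data.Vec.Relation.Binary.Pointwise.Inductive using (Pointwise; []; _∷_)
open import Data.Sum.Base using (_⊎_; inj₁; inj₂; [_,_]′)
open import Function.Base using (_∘_; id)
open import Function.Bundles using (_⇔_; mk⇔; Equivalence; Inverse; Bijection)
open import Function.Construct.Composition using (_⇔-∘_)
open import Function.Construct.Identity using (⇔-id)
open import Function.Construct.Symmetry using (⇔-sym)
open import Function.Definitions using (Injective)
open import Level using (0ℓ)
open import Relation.Binary.Bundles using (Poset)
open import Relation.Binary.Definitions using (tri<; tri≈; tri>)
open import Relation.Binary.PropositionalEquality
open import Relation.Nullary using (¬_; contradiction; yes; no)
open import Relation.Unary using (Pred; Decidable; _∈_; _∉_; _⊆_; ∁; ∅)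
open import Relation.Unary.Properties using (∁?)

private
  variable
    n : ℕ

-- Computable functions of several arguments

record Computableᵛ {n} (F : Vec ℕ n → ℕ) : Set where
  constructor computes
  field
    code : Rec n
    runs : ∀ v → code [ v ]⇓ F v

Computable₃ : (ℕ → ℕ → ℕ → ℕ) → Set
Computable₃ f = ∃[ c ] ∀ x y z → c [ x ∷ y ∷ z ∷ [] ]⇓ f x y z

computable₁ : {F : Vec ℕ 1 → ℕ} → Computableᵛ F → Computable (λ x → F (x ∷ []))
computable₁ (computes c r) = c , λ x → r _

computable₂ : {F : Vec ℕ 2 → ℕ} → Computableᵛ F →
              Computable₂ (uncurry λ x y → F (x ∷ y ∷ []))
computable₂ (computes c r) = c , λ x y → r _

computable₃ : {F : Vec ℕ 3 → ℕ} → Computableᵛ F →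
              Computable₃ (λ x y z → F (x ∷ y ∷ z ∷ []))
computable₃ (computes c r) = c , λ x y z → r _

computable-≗ : {f g : ℕ → ℕ} → Computable f → (∀ x → f x ≡ g x) → Computable g
computable-≗ (c , r) eq = c , λ x → subst (c [ x ∷ [] ]⇓_) (eq x) (r x)

computable₂-≗ : {f g : ℕ → ℕ → ℕ} → Computable₂ (uncurry f) →
                (∀ x y → f x y ≡ g x y) → Computable₂ (uncurry g)
computable₂-≗ (c , r) eq = c , λ x y → subst (c [ x ∷ y ∷ [] ]⇓_) (eq x y) (r x y)

varᵛ : (i : Fin n) → Computableᵛ (λ v → lookup v i)
varᵛ i = computes (proj i) λ v → proj⇓ i

v0 : Computableᵛ {suc n} _
v0 = varᵛ zero

v1 : Computableᵛ {suc (suc n)} _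
v1 = varᵛ (suc zero)

v2 : Computableᵛ {suc (suc (suc n))} _
v2 = varᵛ (suc (suc zero))

v3 : Computableᵛ {suc (suc (suc (suc n)))} _
v3 = varᵛ (suc (suc (suc zero)))

v4 : Computableᵛ {suc (suc (suc (suc (suc n))))} _
v4 = varᵛ (suc (suc (suc (suc zero))))

module _ {s : Vec ℕ n → ℕ} (S : Computableᵛ s) where
  private module S = Computableᵛ S

  app₁ : {f : ℕ → ℕ} → Computable f → Computableᵛ (λ v → f (s v))
  app₁ (c , r) = computes (comp c (S.code ∷ [])) λ v → comp⇓ (S.runs v ∷ []) (r _)

  module _ {t : Vec ℕ n → ℕ} (T : Computableᵛ t) where
    private module T = Computableᵛ T

    app₂ : {f : ℕ → ℕ → ℕ} → Computable₂ (uncurry f) →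
           Computableᵛ (λ v → f (s v) (t v))
    app₂ (c , r) = computes (comp c (S.code ∷ T.code ∷ []))
                   λ v → comp⇓ (S.runs v ∷ T.runs v ∷ []) (r _ _)

    module _ {u : Vec ℕ n → ℕ} (U : Computableᵛ u) where
      private module U = Computableᵛ U

      app₃ : {f : ℕ → ℕ → ℕ → ℕ} → Computable₃ f →
             Computableᵛ (λ v → f (s v) (t v) (u v))
      app₃ (c , r) = computes (comp c (S.code ∷ T.code ∷ U.code ∷ []))
                     λ v → comp⇓ (S.runs v ∷ T.runs v ∷ U.runs v ∷ []) (r _ _ _)

suc-computable : Computable suc
suc-computable = succ , λ x → succ⇓

litᵛ : ∀ a → Computableᵛ {n} (λ v → a)
litᵛ zero    = computes (comp zer []) λ v → comp⇓ [] zer⇓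
litᵛ (suc a) = app₁ (litᵛ a) suc-computable

-- The step function receives the counter and then the previous value, in the argument order of
-- `prec`, so that `recᵛ` follows the two evaluation rules clause by clause.
natrec : ℕ → (ℕ → ℕ → ℕ) → ℕ → ℕ
natrec a f zero    = a
natrec a f (suc x) = f x (natrec a f x)

private
  projections-run : ∀ {m} (is : Vec (Fin n) m) (v : Vec ℕ n) →
                    Pointwise (λ g y → g [ v ]⇓ y)
                      (map proj is) (map (lookup v) is)
  projections-run []       v = []
  projections-run (i ∷ is) v = proj⇓ i ∷ projections-run is v

recᵛ : {a : Vec ℕ n → ℕ} {f : Vec ℕ (suc (suc n)) → ℕ} {t : Vec ℕ n → ℕ} →
       Computableᵛ a → Computableᵛ f → Computableᵛ t →
       Computableᵛ (λ v → natrec (a v) (λ x y → f (x ∷ y ∷ v)) (t v))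
recᵛ {n} {a} {f} {t} (computes A a⇓) (computes F f⇓) (computes T t⇓) =
  -- The parameters `v` are handed through by the vector of all projections; `map-lookup-allFin`
  -- identifies their values with `v`.
  computes (comp (prec A F) (T ∷ map proj (allFin n)))
  λ v → comp⇓ (t⇓ v ∷ projections-run (allFin n) v)
              (subst (λ w → prec A F [ t v ∷ w ]⇓ result v) (sym (map-lookup-allFin v))
                     (loop v (t v)))
  where
  result : Vec ℕ n → ℕ
  result v = natrec (a v) (λ x y → f (x ∷ y ∷ v)) (t v)
  loop : ∀ v x → prec A F [ x ∷ v ]⇓ natrec (a v) (λ x y → f (x ∷ y ∷ v)) x
  loop v zero    = prec⇓-zero (a⇓ v)
  loop v (suc x) = prec⇓-suc (loop v x) (f⇓ _)

-- Unbounded search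

Zero : (ℕ → ℕ) → Set
Zero f = ∃[ y ] f y ≡ 0

-- The given zero bounds the search: recursion on it, with `f` shifted by one each time. The
-- minimality clause is what `mu⇓` asks for.
leastZero : (f : ℕ → ℕ) → Zero f → ∃[ y ] f y ≡ 0 × (∀ i → i < y → f i ≢ 0)
leastZero f (y , fy≡0) = go f y fy≡0
  where
  go : ∀ f y → f y ≡ 0 → ∃[ y ] f y ≡ 0 × (∀ i → i < y → f i ≢ 0)
  go f zero    eq = zero , eq , λ i ()
  go f (suc y) eq with f 0 ≟ 0
  ... | yes f0≡0 = zero , f0≡0 , λ i ()
  ... | no f0≢0 with go (f ∘ suc) y eq
  ...   | z , fz≡0 , below = suc z , fz≡0 ,
          λ { zero _ → f0≢0 ; (suc i) (s≤s i<z) → below i i<z }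

μ : (f : ℕ → ℕ) → Zero f → ℕ
μ f z = proj₁ (leastZero f z)

μ-zero : (f : ℕ → ℕ) (z : Zero f) → f (μ f z) ≡ 0
μ-zero f z = proj₁ (proj₂ (leastZero f z))

μ-least : (f : ℕ → ℕ) (z : Zero f) → ∀ i → i < μ f z → f i ≢ 0
μ-least f z = proj₂ (proj₂ (leastZero f z))

μᵛ : {f : Vec ℕ (suc n) → ℕ} → Computableᵛ f → (z : ∀ v → Zero (λ y → f (y ∷ v))) →
     Computableᵛ (λ v → μ (λ y → f (y ∷ v)) (z v))
μᵛ {f = f} (computes F f⇓) z = computes (mu F) λ v →
  mu⇓ (λ i i<y → positive (μ-least (λ y → f (y ∷ v)) (z v) i i<y) (f⇓ (i ∷ v)))
      (subst (F [ μ (λ y → f (y ∷ v)) (z v) ∷ v ]⇓_) (μ-zero _ (z v)) (f⇓ _))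
  where
  positive : ∀ {w y} → y ≢ 0 → F [ w ]⇓ y → ∃[ x ] F [ w ]⇓ suc x
  positive {y = zero}  y≢0 r = contradiction refl y≢0
  positive {y = suc _} y≢0 r = _ , r

-- Arithmetic

-- Zero stands for true, in agreement with `δ` and `_∸_` as tests for equality and order.
if0 : ℕ → ℕ → ℕ → ℕ
if0 zero    a b = a
if0 (suc _) a b = b

if0-zero : ∀ {c a b} → c ≡ 0 → if0 c a b ≡ a
if0-zero refl = refl

if0-suc : ∀ {c a b u} → c ≡ suc u → if0 c a b ≡ b
if0-suc refl = refl

δ : ℕ → ℕ → ℕ
δ x y = (x ∸ y) + (y ∸ x)

δ≡0 : ∀ {x} {y} → x ≡ y → δ x y ≡ 0
δ≡0 {x} refl rewrite n∸n≡0 x = refl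

δ≡0⇒≡ : ∀ x y → δ x y ≡ 0 → x ≡ y
δ≡0⇒≡ x y eq = ≤-antisym (m∸n≡0⇒m≤n (m+n≡0⇒m≡0 _ eq))
                         (m∸n≡0⇒m≤n (m+n≡0⇒n≡0 (x ∸ y) eq))

+-computable : Computable₂ (uncurry _+_)
+-computable = computable₂-≗ (computable₂ (recᵛ v1 (app₁ v1 suc-computable) v0)) eq
  where
  eq : ∀ x y → natrec y (λ _ r → suc r) x ≡ x + y
  eq zero    y = refl
  eq (suc x) y = cong suc (eq x y)

*-computable : Computable₂ (uncurry _*_)
*-computable = computable₂-≗ (computable₂ (recᵛ (litᵛ 0) (app₂ v3 v1 +-computable) v0)) eq
  where
  eq : ∀ x y → natrec 0 (λ _ r → y + r) x ≡ x * y
  eq zero    y = refl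
  eq (suc x) y = cong (y +_) (eq x y)

pred-computable : Computable pred
pred-computable = computable-≗ (computable₁ (recᵛ (litᵛ 0) v0 v0))
                  λ { zero → refl ; (suc x) → refl }

∸-computable : Computable₂ (uncurry _∸_)
∸-computable = computable₂-≗ (computable₂ (recᵛ v0 (app₁ v1 pred-computable) v1)) eq
  where
  eq : ∀ x y → natrec x (λ _ r → pred r) y ≡ x ∸ y
  eq x zero    = refl
  eq x (suc y) = trans (cong pred (eq x y)) (pred[m∸n]≡m∸[1+n] x y)

δ-computable : Computable₂ (uncurry δ)
δ-computable = computable₂ (app₂ (app₂ v0 v1 ∸-computable) (app₂ v1 v0 ∸-computable) +-computable)

if0-computable : Computable₃ if0
if0-computable = let c , r = computable₃ (recᵛ v1 v4 v0) in
                 c , λ x y z → subst (c [ x ∷ y ∷ z ∷ [] ]⇓_) (eq x y z) (r x y z)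
  where
  eq : ∀ x a b → natrec a (λ _ _ → b) x ≡ if0 x a b
  eq zero    a b = refl
  eq (suc x) a b = refl

-- Cantor pairing

triangle : ℕ → ℕ
triangle = natrec 0 (λ i r → suc i + r)

triangle-computable : Computable triangle
triangle-computable = computable₁ (recᵛ (litᵛ 0) (app₂ (app₁ v0 suc-computable) v1 +-computable) v0)

triangle-mono : ∀ {s t} → s ≤ t → triangle s ≤ triangle t
triangle-mono z≤n = z≤n
triangle-mono (s≤s s≤t) = s≤s (+-mono-≤ s≤t (triangle-mono s≤t))

n≤triangle : ∀ n → n ≤ triangle n
n≤triangle zero    = z≤n
n≤triangle (suc n) = m≤m+n (suc n) (triangle n)

root-exists : ∀ n → Zero (λ r → suc n ∸ triangle (suc r))
root-exists n = n , m≤n⇒m∸n≡0 (n≤triangle (suc n))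

-- The largest r with `triangle r` at most n, found as the least r for which `triangle (suc r)`
-- exceeds n.
root : ℕ → ℕ
root n = μ (λ r → suc n ∸ triangle (suc r)) (root-exists n)

root-computable : Computable root
root-computable = computable₁ (μᵛ
  (app₂ (app₁ v1 suc-computable) (app₁ (app₁ v0 suc-computable) triangle-computable) ∸-computable)
  λ { (n ∷ []) → root-exists n })

-- The next triangular number is larger than `triangle s` by s + 1, so an offset of at most s does
-- not reach it.
root-triangle : ∀ {a s} → a ≤ s → root (triangle s + a) ≡ s
root-triangle {a} {s} a≤s = ≤-antisym (≮⇒≥ above) (≮⇒≥ below)
  where
  m : ℕ
  m = triangle s + a
  above : ¬ s < root m
  above s<r = μ-least (λ r → suc m ∸ triangle (suc r)) (root-exists m) s s<r
    (m≤n⇒m∸n≡0 (s≤s (≤-trans (+-monoʳ-≤ (triangle s) a≤s) (≤-reflexive (+-comm (triangle s) s)))))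
  below : ¬ root m < s
  below r<s = <⇒≱ (m∸n≡0⇒m≤n (μ-zero (λ r → suc m ∸ triangle (suc r)) (root-exists m)))
                  (≤-trans (triangle-mono r<s) (m≤m+n (triangle s) a))

abstract
  -- Cantor's enumeration by diagonals: the pairs with sum s fill the block that starts at
  -- `triangle s`, in the order of their first components. Hence `root` recovers the sum and the
  -- offset is the first component.
  pair : ℕ → ℕ → ℕ
  pair a b = triangle (a + b) + a

  π₁ : ℕ → ℕ
  π₁ n = n ∸ triangle (root n)

  π₂ : ℕ → ℕ
  π₂ n = root n ∸ π₁ n

  π₁-pair : ∀ a b → π₁ (pair a b) ≡ a
  π₁-pair a b rewrite root-triangle (m≤m+n a b) = m+n∸m≡n (triangle (a + b)) a

  π₂-pair : ∀ a b → π₂ (pair a b) ≡ b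
  π₂-pair a b rewrite π₁-pair a b | root-triangle (m≤m+n a b) = m+n∸m≡n a b

  pair-computable : Computable₂ (uncurry pair)
  pair-computable = computable₂
    (app₂ (app₁ (app₂ v0 v1 +-computable) triangle-computable) v0 +-computable)

  π₁-computable : Computable π₁
  π₁-computable = computable₁
    (app₂ v0 (app₁ (app₁ v0 root-computable) triangle-computable) ∸-computable)

  π₂-computable : Computable π₂
  π₂-computable = computable₁ (app₂ (app₁ v0 root-computable) (app₁ v0 π₁-computable) ∸-computable)

-- Counting with bounded fibres

length-filter-∁ : ∀ {P : Pred ℕ 0ℓ} (P? : Decidable P) xs →
                  length xs ≡ length (filter P? xs) + length (filter (∁? P?) xs)
length-filter-∁ P? []       = refl
length-filter-∁ P? (x ∷ xs) with P? x
... | yes _ = cong suc (length-filter-∁ P? xs)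
... | no  _ = trans (cong suc (length-filter-∁ P? xs)) (sym (+-suc _ _))

-- There are at most b points above each of the n values of `g`. The induction removes the whole
-- fibre over the last value; what remains has values with an earlier index.
fibres-over-range : ∀ {b f} → FibresBoundedBy b f → ∀ n (g : ℕ → ℕ) xs → Unique xs →
                    All (λ x → ∃[ u ] u < n × f x ≡ g u) xs → length xs ≤ b * n
fibres-over-range f-fibres zero    g []       _  _  = z≤n
fibres-over-range f-fibres zero    g (x ∷ xs) _  ((_ , () , _) All.∷ _)
fibres-over-range {b} {f} f-fibres (suc n) g xs xs! xs∈ = begin
  length xs
    ≡⟨ length-filter-∁ last? xs ⟩
  length (filter last? xs) + length (filter (∁? last?) xs)
    ≤⟨ +-mono-≤ (f-fibres (g n) _ (Unique.filter⁺ last? xs!) (All.all-filter last? xs))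
                (fibres-over-range f-fibres n g _ (Unique.filter⁺ (∁? last?) xs!)
                  (All.zipWith earlier ( All.filter⁺ (∁? last?) xs∈
                                       , All.all-filter (∁? last?) xs))) ⟩
  b + b * n
    ≡⟨ *-suc b n ⟨
  b * suc n ∎
  where
  open ≤-Reasoning
  last? : Decidable (λ x → f x ≡ g n)
  last? x = f x ≟ g n
  earlier : ∀ {x} → (∃[ u ] u < suc n × f x ≡ g u) × f x ≢ g n → ∃[ u ] u < n × f x ≡ g u
  earlier ((u , u≤n , fx≡gu) , fx≢gn) =
    u , ≤∧≢⇒< (≤-pred u≤n) (λ { refl → fx≢gn fx≡gu }) , fx≡gu

-- Greedy injections

-- Yields `suc u` for the last u < n with `h u` equal to y, and 0 if there is none; the shift keeps
-- the index 0 apart from failure.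
scan : (ℕ → ℕ) → ℕ → ℕ → ℕ
scan h y = natrec 0 (λ u r → if0 (δ (h u) y) (suc u) r)

scan≡suc : ∀ h y n {u} → scan h y n ≡ suc u → u < n × h u ≡ y
scan≡suc h y (suc n) eq with δ (h n) y in δ-eq
scan≡suc h y (suc n) refl | zero = ≤-refl , δ≡0⇒≡ (h n) y δ-eq
scan≡suc h y (suc n) eq | suc _ with u<n , hu≡y ← scan≡suc h y n eq = m<n⇒m<1+n u<n , hu≡y

scan≡0 : ∀ h y n → scan h y n ≡ 0 → ∀ {u} → u < n → h u ≢ y
scan≡0 h y (suc n) eq u<1+n hu≡y with δ (h n) y in δ-eq
... | suc _ with m≤n⇒m<n∨m≡n (≤-pred u<1+n)
...   | inj₁ u<n  = scan≡0 h y n eq u<n hu≡y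
...   | inj₂ refl with () ← trans (sym (δ≡0 hu≡y)) δ-eq

-- A state s offers the value cand s; if that value is occupied by u, the walk
-- moves on to next s u.
module Greedy
  {A B : Pred ℕ 0ℓ} (M : ℕ) (cand init : ℕ → ℕ) (next : ℕ → ℕ → ℕ)
  (cand-computable : Computable cand)
  (init-computable : Computable init)
  (next-computable : Computable₂ (uncurry next))
  (cand-fibres : FibresBoundedBy M cand)
  (init-colour : ∀ x → x ∈ A ⇔ cand (init x) ∈ B)
  (next-colour : ∀ s u → u ∈ A ⇔ cand s ∈ B → cand s ∈ B ⇔ cand (next s u) ∈ B)
  (next-injective : ∀ s s′ u u′ → (u ≡ u′ → cand s ≡ cand s′) →
                    next s u ≡ next s′ u′ → s ≡ s′)
  (next≢init : ∀ s u x → u ≢ x → next s u ≢ init x)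
  where

  dropᵖ : ℕ → ℕ → ℕ
  dropᵖ H = natrec H (λ _ r → π₂ r)

  -- A history of n values keeps the latest one outermost, so the value of u lies beneath n - (u +
  -- 1) later ones.
  entry : ℕ → ℕ → ℕ → ℕ
  entry n H u = π₁ (dropᵖ H (n ∸ suc u))

  user : ℕ → ℕ → ℕ → ℕ
  user n H y = scan (entry n H) y n

  -- A state with a free candidate is left alone, so running the walk longer than necessary does no
  -- harm. `pred` undoes the shift in `scan`.
  step : ℕ → ℕ → ℕ → ℕ
  step n H s = if0 (user n H (cand s)) s (next s (pred (user n H (cand s))))

  walk : ℕ → ℕ → ℕ → ℕ
  walk n H = natrec (init n) (λ _ s → step n H s)

  -- The running time is fixed in advance: n values are occupied, and each is the candidate of at
  -- most M states. Primitive recursion thus replaces a search.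
  value : ℕ → ℕ → ℕ
  value n H = cand (walk n H (M * n))

  -- Course-of-values recursion: each value depends on all earlier ones, so the recursion carries
  -- the coded list of them.
  history : ℕ → ℕ
  history = natrec 0 (λ n H → pair (value n H) H)

  greedy : ℕ → ℕ
  greedy n = value n (history n)

  entry-computable : Computable₃ entry
  entry-computable = computable₃
    (app₁ (recᵛ v1 (app₁ v1 π₂-computable) (app₂ v0 (app₁ v2 suc-computable) ∸-computable))
          π₁-computable)

  user-computable : Computable₃ user
  user-computable = computable₃
    (recᵛ (litᵛ 0)
          (app₃ (app₂ (app₃ v2 v3 v0 entry-computable) v4 δ-computable)
                (app₁ v0 suc-computable) v1 if0-computable)
          v0)

  step-computable : Computable₃ step
  step-computable = computable₃
    (app₃ used v2 (app₂ v2 (app₁ used pred-computable) next-computable) if0-computable)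
    where
    used : Computableᵛ _
    used = app₃ v0 v1 (app₁ v2 cand-computable) user-computable

  value-computable : Computable₂ (uncurry value)
  value-computable = computable₂
    (app₁ (recᵛ (app₁ v0 init-computable) (app₃ v2 v3 v1 step-computable)
                (app₂ (litᵛ M) v0 *-computable))
          cand-computable)

  history-computable : Computable history
  history-computable = computable₁
    (recᵛ (litᵛ 0) (app₂ (app₂ v0 v1 value-computable) v1 pair-computable) v0)

  greedy-computable : Computable greedy
  greedy-computable = computable₁ (app₂ v0 (app₁ v0 history-computable) value-computable)

  dropᵖ-history : ∀ m d → dropᵖ (history (d + m)) d ≡ history m
  dropᵖ-history m zero    = refl
  dropᵖ-history m (suc d) = begin
    π₂ (dropᵖ (history (suc d + m)) d)  ≡⟨ cong (λ k → π₂ (dropᵖ (history k) d)) (+-suc d m) ⟨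
    π₂ (dropᵖ (history (d + suc m)) d)  ≡⟨ cong π₂ (dropᵖ-history (suc m) d) ⟩
    π₂ (history (suc m))                ≡⟨ π₂-pair (greedy m) (history m) ⟩
    history m                           ∎
    where open ≡-Reasoning

  entry-history : ∀ {n u} → u < n → entry n (history n) u ≡ greedy u
  entry-history {n} {u} u<n = begin
    π₁ (dropᵖ (history n) d)            ≡⟨ cong (λ k → π₁ (dropᵖ (history k) d)) (m∸n+n≡m u<n) ⟨
    π₁ (dropᵖ (history (d + suc u)) d)  ≡⟨ cong π₁ (dropᵖ-history (suc u) d) ⟩
    π₁ (history (suc u))                ≡⟨ π₁-pair (greedy u) (history u) ⟩
    greedy u                            ∎
    where
    open ≡-Reasoning
    d : ℕ
    d = n ∸ suc u

  userᵍ : ℕ → ℕ → ℕ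
  userᵍ n = user n (history n)

  walkᵍ : ℕ → ℕ → ℕ
  walkᵍ n = walk n (history n)

  used⇒ : ∀ n y {u} → userᵍ n y ≡ suc u → u < n × greedy u ≡ y
  used⇒ n y eq with u<n , e≡y ← scan≡suc (entry n (history n)) y n eq =
    u<n , trans (sym (entry-history u<n)) e≡y

  unused⇒ : ∀ n y → userᵍ n y ≡ 0 → ∀ {u} → u < n → greedy u ≢ y
  unused⇒ n y eq u<n gu≡y =
    scan≡0 (entry n (history n)) y n eq u<n (trans (entry-history u<n) gu≡y)

  zero-or-suc : ∀ c → c ≡ 0 ⊎ ∃[ u ] c ≡ suc u
  zero-or-suc zero    = inj₁ refl
  zero-or-suc (suc u) = inj₂ (u , refl)

  stop : ∀ n s → userᵍ n (cand s) ≡ 0 → step n (history n) s ≡ s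
  stop n s = if0-zero

  move : ∀ n s {u} → userᵍ n (cand s) ≡ suc u → step n (history n) s ≡ next s u
  move n s used = trans (if0-suc used) (cong (next s ∘ pred) used)

  -- The user of an occupied candidate is earlier than n, so by the induction hypothesis it has the
  -- colour of that candidate; this is the premise of `next-colour`.
  step-colour : ∀ n → (∀ {u} → u < n → u ∈ A ⇔ greedy u ∈ B) →
                ∀ s → cand s ∈ B ⇔ cand (step n (history n) s) ∈ B
  step-colour n colour s = [ unused , used ]′ (zero-or-suc (userᵍ n (cand s)))
    where
    Preserved : ℕ → Set
    Preserved t = cand s ∈ B ⇔ cand t ∈ B
    unused : userᵍ n (cand s) ≡ 0 → Preserved (step n (history n) s)
    unused eq = subst Preserved (sym (stop n s eq)) (⇔-id _)
    used : (∃[ u ] userᵍ n (cand s) ≡ suc u) → Preserved (step n (history n) s)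
    used (u , eq) = subst Preserved (sym (move n s eq))
      (let u<n , gu≡y = used⇒ n (cand s) eq in
       next-colour s u (subst (λ y → u ∈ A ⇔ y ∈ B) gu≡y (colour u<n)))

  walk-colour : ∀ n → (∀ {u} → u < n → u ∈ A ⇔ greedy u ∈ B) →
                ∀ k → n ∈ A ⇔ cand (walkᵍ n k) ∈ B
  walk-colour n colour zero    = init-colour n
  walk-colour n colour (suc k) = step-colour n colour (walkᵍ n k) ⇔-∘ walk-colour n colour k

  greedy-colour : ∀ x → x ∈ A ⇔ greedy x ∈ B
  greedy-colour = <-rec (λ x → x ∈ A ⇔ greedy x ∈ B)
                  λ n colour → walk-colour n colour (M * n)

  -- A walk that does not stop runs through distinct states, whose candidates
  -- are among the n values already taken; there are at most M * n such states.
  walk-stops : ∀ n → userᵍ n (greedy n) ≡ 0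
  walk-stops n = [ id , (λ { (_ , eq) → contradiction (moving eq) (<-irrefl refl) }) ]′
                 (zero-or-suc (userᵍ n (greedy n)))
    where
    K : ℕ
    K = M * n
    w : ℕ → ℕ
    w = walkᵍ n
    stopped : ∀ k d → userᵍ n (cand (w k)) ≡ 0 → userᵍ n (cand (w (d + k))) ≡ 0
    stopped k zero    e = e
    stopped k (suc d) e = let e′ = stopped k d e in
      trans (cong (userᵍ n ∘ cand) (stop n (w (d + k)) e′)) e′
    Moves : ℕ → Set
    Moves i = ∃[ u ] u < n × greedy u ≡ cand (w i) × w (suc i) ≡ next (w i) u
    moves : ∀ {v} → userᵍ n (cand (w K)) ≡ suc v → ∀ {i} → i ≤ K → Moves i
    moves eq {i} i≤K = [ (λ e → contradiction (halted e) λ ()) , moved ]′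
                       (zero-or-suc (userᵍ n (cand (w i))))
      where
      halted : userᵍ n (cand (w i)) ≡ 0 → suc _ ≡ 0
      halted e = trans (sym eq)
        (trans (cong (userᵍ n ∘ cand ∘ w) (sym (m∸n+n≡m i≤K))) (stopped i (K ∸ i) e))
      moved : (∃[ u ] userᵍ n (cand (w i)) ≡ suc u) → Moves i
      moved (u , e) = let u<n , gu≡c = used⇒ n (cand (w i)) e in
                      u , u<n , gu≡c , move n (w i) e
    -- A repetition is traced back one move at a time by `next-injective`, until the earlier state
    -- is the initial one. By `next≢init`, no move caused by a user other than n leads there.
    distinct : (∀ {i} → i ≤ K → Moves i) → ∀ i j → i < j → j ≤ K → w i ≢ w j
    distinct ms i (suc j) i≤j j<K wi≡wj = from-moves i i≤j wi≡wj (ms (<⇒≤ j<K))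
      where
      from-moves : ∀ i → i < suc j → w i ≡ w (suc j) → Moves j → ⊥
      from-moves zero i≤j wi≡wj (u , u<n , _ , wj≡) =
        next≢init (w j) u n (<⇒≢ u<n) (sym (trans wi≡wj wj≡))
      from-moves (suc i) (s≤s i<j) wi≡wj (u , u<n , gu≡ , wj≡) =
        let u′ , u′<n , gu′≡ , wi≡ = ms (<⇒≤ (<-trans i<j j<K)) in
        distinct ms i j i<j (<⇒≤ j<K)
          (next-injective (w i) (w j) u′ u
            -- A user occupies a single value, so equal users sit on equal candidates.
            (λ u′≡u → trans (sym gu′≡) (trans (cong greedy u′≡u) gu≡))
            (trans (sym wi≡) (trans wi≡wj wj≡)))
    moving : ∀ {v} → userᵍ n (cand (w K)) ≡ suc v → suc K ≤ K
    moving eq = ≤-trans (≤-reflexive (sym (length-applyUpTo w (suc K))))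
      (fibres-over-range cand-fibres n greedy (applyUpTo w (suc K))
        (Unique.applyUpTo⁺₁ w (suc K) λ i<j j≤K → distinct (moves eq) _ _ i<j (≤-pred j≤K))
        (All.applyUpTo⁺₁ w (suc K) λ i≤K →
          let u , u<n , gu≡c , _ = moves eq (≤-pred i≤K) in u , u<n , sym gu≡c))

  -- The later of two points ends at a value that no earlier point has taken.
  greedy-injective : Injective _≡_ _≡_ greedy
  greedy-injective {x} {y} gx≡gy with <-cmp x y
  ... | tri< x<y _ _ = contradiction gx≡gy (unused⇒ y (greedy y) (walk-stops y) x<y)
  ... | tri≈ _ x≡y _ = x≡y
  ... | tri> _ _ y<x = contradiction (sym gx≡gy) (unused⇒ x (greedy x) (walk-stops x) y<x)

  greedy-reduction : A ≤₁ B
  greedy-reduction = greedy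
    , record { computable = greedy-computable ; reduces = greedy-colour }
    , greedy-injective

-- Reductions

private
  variable
    A A′ B B′ C D : Pred ℕ 0ℓ

module _ (F : A ≤₁ B) where
  ≤₁-fun : ℕ → ℕ
  ≤₁-fun = proj₁ F

  ≤₁-reduction : IsManyOneReduction A B ≤₁-fun
  ≤₁-reduction = proj₁ (proj₂ F)

  ≤₁-computable : Computable ≤₁-fun
  ≤₁-computable = IsManyOneReduction.computable ≤₁-reduction

  ≤₁-reduces : ∀ x → x ∈ A ⇔ ≤₁-fun x ∈ B
  ≤₁-reduces = IsManyOneReduction.reduces ≤₁-reduction

  ≤₁-injective : Injective _≡_ _≡_ ≤₁-fun
  ≤₁-injective = proj₂ (proj₂ F)

Disjoint : A ≤₁ C → B ≤₁ C → Set
Disjoint F G = ∀ x y → ≤₁-fun F x ≢ ≤₁-fun G y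

∘-computable : ∀ {f g} → Computable f → Computable g → Computable (g ∘ f)
∘-computable f g = computable₁ (app₁ (app₁ v0 f) g)

∘-reduction : ∀ {f g} → IsManyOneReduction A B f → IsManyOneReduction B C g →
              IsManyOneReduction A C (g ∘ f)
∘-reduction {f = f} F G = record
  { computable = ∘-computable F.computable G.computable
  ; reduces    = λ x → G.reduces (f x) ⇔-∘ F.reduces x
  }
  where
  module F = IsManyOneReduction F
  module G = IsManyOneReduction G

id-computable : Computable id
id-computable = computable₁ v0

injective-fibres : ∀ {f} → Injective _≡_ _≡_ f → FibresBoundedBy 1 f
injective-fibres f-inj y []           _ _ = z≤n
injective-fibres f-inj y (_ ∷ [])     _ _ = s≤s z≤n
injective-fibres f-inj y (x ∷ z ∷ xs) ((x≢z All.∷ _) AllPairs.∷ _) (fx≡y All.∷ fz≡y All.∷ _) =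
  contradiction (f-inj (trans fx≡y (sym fz≡y))) x≢z

∘-fibres : ∀ {b f g} → Injective _≡_ _≡_ f → FibresBoundedBy b g → FibresBoundedBy b (g ∘ f)
∘-fibres {f = f} f-inj g-fibres y xs xs! gfxs≡y =
  subst (_≤ _) (length-map f xs)
        (g-fibres y (List.map f xs) (Unique.map⁺ f-inj xs!) (All.map⁺ gfxs≡y))

≤₁⇒≤bfo : A ≤₁ B → A ≤bfo B
≤₁⇒≤bfo F = ≤₁-fun F , ≤₁-reduction F , 1 , ≤-refl , injective-fibres (≤₁-injective F)

≤₁-≤bfo-trans : A ≤₁ B → B ≤bfo C → A ≤bfo C
≤₁-≤bfo-trans F (g , G , b , 1≤b , g-fibres) =
  g ∘ ≤₁-fun F , ∘-reduction (≤₁-reduction F) G , b , 1≤b , ∘-fibres (≤₁-injective F) g-fibres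

≡₁-trans : A ≡₁ B → B ≡₁ C → A ≡₁ C
≡₁-trans (A≤B , B≤A) (B≤C , C≤B) = ≤₁-trans A≤B B≤C , ≤₁-trans C≤B B≤A

unique-map : ∀ {P : Pred ℕ 0ℓ} {f : ℕ → ℕ} {xs} →
             (∀ {x y} → x ∈ P → y ∈ P → f x ≡ f y → x ≡ y) →
             All P xs → Unique xs → Unique (List.map f xs)
unique-map f-inj All.[]         AllPairs.[]            = AllPairs.[]
unique-map f-inj (px All.∷ pxs) (x∉xs AllPairs.∷ xs!) =
  All.map⁺ (All.zipWith (λ { (x≢y , py) fx≡fy → x≢y (f-inj px py fx≡fy) }) (x∉xs , pxs))
  AllPairs.∷ unique-map f-inj pxs xs!

restricted-fibres : ∀ {b f g} {P : Pred ℕ 0ℓ} → FibresBoundedBy b f →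
                    (∀ {x y} → x ∈ P → y ∈ P → g x ≡ g y → x ≡ y) →
                    ∀ y xs → Unique xs → All P xs → All (λ x → f (g x) ≡ y) xs → length xs ≤ b
restricted-fibres {g = g} f-fibres g-inj y xs xs! pxs fgxs≡y =
  subst (_≤ _) (length-map g xs)
        (f-fibres y (List.map g xs) (unique-map g-inj pxs xs!) (All.map⁺ fgxs≡y))

-- Each member has a code of its own, with nothing uniform in the index. The family being finite,
-- nested case distinctions assemble these codes into one.
finite-cases : ∀ m (f : Fin m → ℕ → ℕ) → (∀ i → Computable (f i)) →
               ∃[ F ] Computable₂ (uncurry F) × (∀ i x → F (toℕ i) x ≡ f i x)
finite-cases zero    f fᶜ = (λ _ _ → 0) , computable₂ (litᵛ 0) , λ ()
finite-cases (suc m) f fᶜ with F , Fᶜ , F≡ ← finite-cases m (f ∘ suc) (fᶜ ∘ suc) =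
  (λ i x → if0 i (f zero x) (F (pred i) x))
  , computable₂ (app₃ v0 (app₁ v1 (fᶜ zero)) (app₂ (app₁ v0 pred-computable) v1 Fᶜ) if0-computable)
  , λ { zero x → refl ; (suc i) x → F≡ i x }

module Reductions (P : Pairings) where
  open Pairings P
  open Joins P

  module _ {m : ℕ} .{{_ : NonZero m}} where
    idx : ℕ → Fin m
    idx z = proj₁ (Inverse.from (finPairing m) z)

    arg : ℕ → ℕ
    arg z = proj₂ (Inverse.from (finPairing m) z)

    idx-computable : Computable (toℕ ∘ idx)
    idx-computable = proj₁ (finPairing⁻¹-computable m)

    arg-computable : Computable arg
    arg-computable = proj₂ (finPairing⁻¹-computable m)

    ⟨idx,arg⟩ : ∀ z → ⟨ idx z , arg z ⟩ᶠ ≡ z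
    ⟨idx,arg⟩ = Inverse.strictlyInverseˡ (finPairing m)

    idx-⟨⟩ : ∀ (i : Fin m) x → idx ⟨ i , x ⟩ᶠ ≡ i
    idx-⟨⟩ i x = cong proj₁ (Inverse.strictlyInverseʳ (finPairing m) (i , x))

    arg-⟨⟩ : ∀ (i : Fin m) x → arg ⟨ i , x ⟩ᶠ ≡ x
    arg-⟨⟩ i x = cong proj₂ (Inverse.strictlyInverseʳ (finPairing m) (i , x))

    ⟨⟩-computable : (i : Fin m) → Computable ⟨ i ,_⟩ᶠ
    ⟨⟩-computable i =
      comp (proj₁ (finPairing-computable m)) (Computableᵛ.code (litᵛ {1} (toℕ i)) ∷ proj zero ∷ [])
      , λ x → comp⇓ (Computableᵛ.runs (litᵛ (toℕ i)) (x ∷ []) ∷ proj⇓ zero ∷ [])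
                    (proj₂ (finPairing-computable m) i x)

    ⟨⟩-injective : (i : Fin m) → Injective _≡_ _≡_ ⟨ i ,_⟩ᶠ
    ⟨⟩-injective i {x} {y} eq = trans (sym (arg-⟨⟩ i x)) (trans (cong arg eq) (arg-⟨⟩ i y))

    idx-arg-injective : ∀ {x y} → idx x ≡ idx y → arg x ≡ arg y → x ≡ y
    idx-arg-injective {x} {y} i≡ a≡ =
      trans (sym (⟨idx,arg⟩ x)) (trans (cong₂ ⟨_,_⟩ᶠ i≡ a≡) (⟨idx,arg⟩ y))

  -- Binary joins

  inl inr : ℕ → ℕ
  inl = ⟨ zero {1} ,_⟩ᶠ
  inr = ⟨ suc {1} zero ,_⟩ᶠ

  inl-computable : Computable inl
  inl-computable = ⟨⟩-computable (zero {1})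

  inr-computable : Computable inr
  inr-computable = ⟨⟩-computable (suc {1} zero)

  inl-injective : Injective _≡_ _≡_ inl
  inl-injective = ⟨⟩-injective (zero {1})

  inr-injective : Injective _≡_ _≡_ inr
  inr-injective = ⟨⟩-injective (suc {1} zero)

  inl≢inr : ∀ {x y} → inl x ≢ inr y
  inl≢inr {x} {y} eq with () ←
    trans (sym (idx-⟨⟩ (zero {1}) x)) (trans (cong idx eq) (idx-⟨⟩ (suc {1} zero) y))

  data Side : Pred ℕ 0ℓ where
    left  : ∀ x → Side (inl x)
    right : ∀ x → Side (inr x)

  side : ∀ z → Side z
  side z = subst Side (⟨idx,arg⟩ z) (at (idx z))
    where
    at : (i : Fin 2) → Side ⟨ i , arg {2} z ⟩ᶠ
    at zero       = left _
    at (suc zero) = right _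

  inl-∈ : ∀ x → x ∈ A ⇔ inl x ∈ A ⊕ B
  inl-∈ {A} x = mk⇔ (λ x∈A → inj₁ (x , x∈A , refl)) λ
    { (inj₁ (y , y∈A , eq)) → subst A (sym (inl-injective eq)) y∈A
    ; (inj₂ (y , _ , eq))   → contradiction eq inl≢inr
    }

  inr-∈ : ∀ x → x ∈ B ⇔ inr x ∈ A ⊕ B
  inr-∈ {B} x = mk⇔ (λ x∈B → inj₂ (x , x∈B , refl)) λ
    { (inj₁ (y , _ , eq))   → contradiction (sym eq) inl≢inr
    ; (inj₂ (y , y∈B , eq)) → subst B (sym (inr-injective eq)) y∈B
    }

  ≤₁-inl : A ≤₁ A ⊕ B
  ≤₁-inl = inl , record { computable = inl-computable ; reduces = inl-∈ } , inl-injective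

  ≤₁-inr : B ≤₁ A ⊕ B
  ≤₁-inr = inr , record { computable = inr-computable ; reduces = inr-∈ } , inr-injective

  join : (ℕ → ℕ) → (ℕ → ℕ) → ℕ → ℕ
  join f g z = if0 (toℕ (idx {2} z)) (f (arg {2} z)) (g (arg {2} z))

  module _ (f g : ℕ → ℕ) where
    join-inl : ∀ x → join f g (inl x) ≡ f x
    join-inl x = trans (if0-zero (cong toℕ (idx-⟨⟩ (zero {1}) x))) (cong f (arg-⟨⟩ (zero {1}) x))

    join-inr : ∀ x → join f g (inr x) ≡ g x
    join-inr x = trans (if0-suc (cong toℕ (idx-⟨⟩ (suc {1} zero) x)))
                       (cong g (arg-⟨⟩ (suc {1} zero) x))

    join≢ : ∀ {c} → (∀ x → f x ≢ c) → (∀ x → g x ≢ c) → ∀ z → join f g z ≢ c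
    join≢ f≢ g≢ z eq with side z
    ... | left x  = f≢ x (trans (sym (join-inl x)) eq)
    ... | right x = g≢ x (trans (sym (join-inr x)) eq)

    join-computable : Computable f → Computable g → Computable (join f g)
    join-computable fᶜ gᶜ = computable₁
      (app₃ (app₁ v0 (idx-computable {2})) (app₁ (app₁ v0 (arg-computable {2})) fᶜ)
            (app₁ (app₁ v0 (arg-computable {2})) gᶜ) if0-computable)

    join-reduction : IsManyOneReduction A C f → IsManyOneReduction B C g →
                     IsManyOneReduction (A ⊕ B) C (join f g)
    join-reduction {A} {C} {B} F G = record
      { computable = join-computable F.computable G.computable ; reduces = λ z → on (side z) }
      where
      module F = IsManyOneReduction F
      module G = IsManyOneReduction G
      on : ∀ {z} → Side z → z ∈ A ⊕ B ⇔ join f g z ∈ C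
      on (left x)  = subst (λ c → inl x ∈ A ⊕ B ⇔ c ∈ C) (sym (join-inl x))
                           (F.reduces x ⇔-∘ ⇔-sym (inl-∈ x))
      on (right x) = subst (λ c → inr x ∈ A ⊕ B ⇔ c ∈ C) (sym (join-inr x))
                           (G.reduces x ⇔-∘ ⇔-sym (inr-∈ x))

    -- A fibre of `join f g` splits by sides. On either side `arg` is injective, so it carries the
    -- list to one without repetitions in a fibre of `f` or of `g`.
    join-fibres : ∀ {a b} → FibresBoundedBy a f → FibresBoundedBy b g →
                  FibresBoundedBy (a + b) (join f g)
    join-fibres {a} {b} f-fibres g-fibres y zs zs! zs↦y = begin
      length zs
        ≡⟨ length-filter-∁ left? zs ⟩
      length (filter left? zs) + length (filter (∁? left?) zs)
        ≤⟨ +-mono-≤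
             (restricted-fibres f-fibres (λ {x} {y} i≡ j≡ → idx-arg-injective (trans i≡ (sym j≡)))
               y _ (Unique.filter⁺ left? zs!) (All.all-filter left? zs)
               (All.zipWith (λ {z} → left-value {z})
                 (All.all-filter left? zs , All.filter⁺ left? zs↦y)))
             (restricted-fibres g-fibres (λ {x} {y} i≢ j≢ →
                 idx-arg-injective (trans (≢zero i≢) (sym (≢zero j≢))))
               y _ (Unique.filter⁺ (∁? left?) zs!) (All.all-filter (∁? left?) zs)
               (All.zipWith (λ {z} → right-value {z})
                 (All.all-filter (∁? left?) zs , All.filter⁺ (∁? left?) zs↦y))) ⟩
      a + b ∎
      where
      open ≤-Reasoning
      left? : Decidable (λ z → idx {2} z ≡ zero)
      left? z = idx {2} z Fin.≟ zero
      ≢zero : {i : Fin 2} → i ≢ zero → i ≡ suc zero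
      ≢zero {zero}     i≢0 = contradiction refl i≢0
      ≢zero {suc zero} _   = refl
      left-value : ∀ {z} → idx {2} z ≡ zero × join f g z ≡ y → f (arg {2} z) ≡ y
      left-value (i≡0 , eq) = trans (sym (if0-zero (cong toℕ i≡0))) eq
      right-value : ∀ {z} → idx {2} z ≢ zero × join f g z ≡ y → g (arg {2} z) ≡ y
      right-value (i≢0 , eq) = trans (sym (if0-suc (cong toℕ (≢zero i≢0)))) eq

  ⊕-least : (F : A ≤₁ C) (G : B ≤₁ C) → Disjoint F G → A ⊕ B ≤₁ C
  ⊕-least F G disjoint = join f g , join-reduction f g (≤₁-reduction F) (≤₁-reduction G) , injective
    where
    f g : ℕ → ℕ
    f = ≤₁-fun F
    g = ≤₁-fun G
    injective : Injective _≡_ _≡_ (join f g)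
    injective {x} {y} eq with side x | side y
    ... | left a  | left b  =
      cong inl (≤₁-injective F (trans (sym (join-inl f g a)) (trans eq (join-inl f g b))))
    ... | left a  | right b =
      contradiction (trans (sym (join-inl f g a)) (trans eq (join-inr f g b))) (disjoint a b)
    ... | right a | left b  =
      contradiction (trans (sym (join-inl f g b)) (trans (sym eq) (join-inr f g a))) (disjoint b a)
    ... | right a | right b =
      cong inr (≤₁-injective G (trans (sym (join-inr f g a)) (trans eq (join-inr f g b))))

  ⊕-least-bfo : A ≤bfo C → B ≤bfo C → A ⊕ B ≤bfo C
  ⊕-least-bfo (f , F , a , 1≤a , f-fibres) (g , G , b , _ , g-fibres) =
    join f g , join-reduction f g F G , a + b , ≤-trans 1≤a (m≤m+n a b)
    , join-fibres f g f-fibres g-fibres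

  ⊕-mono : A ≤₁ A′ → B ≤₁ B′ → A ⊕ B ≤₁ A′ ⊕ B′
  ⊕-mono F G = ⊕-least (≤₁-trans F ≤₁-inl) (≤₁-trans G ≤₁-inr) λ _ _ → inl≢inr

  ⊕-comm : A ⊕ B ≤₁ B ⊕ A
  ⊕-comm = ⊕-least ≤₁-inr ≤₁-inl λ _ _ eq → inl≢inr (sym eq)

  ⊕-assoc : (A ⊕ B) ⊕ C ≤₁ A ⊕ (B ⊕ C)
  ⊕-assoc = ⊕-least (⊕-mono ≤₁-refl ≤₁-inl) (≤₁-trans ≤₁-inr ≤₁-inr) λ z c →
    join≢ inl (inr ∘ inl) (λ _ → inl≢inr)
      (λ _ eq → inl≢inr (inr-injective eq)) z

  -- Exchanging the roles of B and C turns this into its own converse.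
  ⊕-interchange : (A ⊕ B) ⊕ (C ⊕ D) ≤₁ (A ⊕ C) ⊕ (B ⊕ D)
  ⊕-interchange = ⊕-least (⊕-mono ≤₁-inl ≤₁-inl) (⊕-mono ≤₁-inr ≤₁-inr) λ z w eq →
    join≢ (inl ∘ inr) (inr ∘ inr)
      (λ c eq′ → join≢ (inl ∘ inl) (inr ∘ inl)
        (λ a eq″ → inl≢inr (inl-injective eq″))
        (λ b eq″ → inl≢inr (sym eq″)) z (sym eq′))
      (λ d eq′ → join≢ (inl ∘ inl) (inr ∘ inl)
        (λ a eq″ → inl≢inr eq″)
        (λ b eq″ → inl≢inr (inr-injective eq″)) z (sym eq′))
      w (sym eq)

  -- Multiples

  -- Disjointly placed copies of A in C amount to a reduction of `autojoin m A` to C: see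
  -- `autojoin-packing` and `autojoin-least`. The laws of autojoins thereby become reindexings along
  -- maps of `Fin`.
  Packing : ℕ → Pred ℕ 0ℓ → Pred ℕ 0ℓ → Set
  Packing m A C = Σ[ F ∈ (Fin m → A ≤₁ C) ] ∀ i j x y → ≤₁-fun (F i) x ≡ ≤₁-fun (F j) y → i ≡ j

  trans-packing : ∀ {m} → A ≤₁ B → Packing m B C → Packing m A C
  trans-packing F (G , sep) = (λ i → ≤₁-trans F (G i)) , λ i j x y → sep i j _ _

  packing-reindex : ∀ {m n} {h : Fin m → Fin n} → Injective _≡_ _≡_ h →
                    Packing n A C → Packing m A C
  packing-reindex {h = h} h-inj (F , sep) = F ∘ h , λ i j x y eq → h-inj (sep (h i) (h j) x y eq)

  module _ {m : ℕ} .{{_ : NonZero m}} where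
    ⟨⟩-∈ : ∀ (i : Fin m) x → x ∈ A ⇔ ⟨ i , x ⟩ᶠ ∈ autojoin m A
    ⟨⟩-∈ {A} i x = mk⇔ (λ x∈A → i , x , x∈A , refl) λ
      { (j , y , y∈A , eq) →
        subst A (trans (sym (arg-⟨⟩ j y)) (trans (cong arg (sym eq)) (arg-⟨⟩ i x))) y∈A }

    autojoin-packing : Packing m A (autojoin m A)
    autojoin-packing =
      (λ i → ⟨ i ,_⟩ᶠ , record { computable = ⟨⟩-computable i ; reduces = ⟨⟩-∈ i } , ⟨⟩-injective i)
      , λ i j x y eq → trans (sym (idx-⟨⟩ i x)) (trans (cong idx eq) (idx-⟨⟩ j y))

    module _ (F : Fin m → A ≤₁ C) where
      cases : ℕ → ℕ
      cases z = ≤₁-fun (F (idx z)) (arg {m} z)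

      cases-computable : Computable cases
      cases-computable with G , Gᶜ , G≡ ← finite-cases m (≤₁-fun ∘ F) (≤₁-computable ∘ F) =
        computable-≗ (computable₁ (app₂ (app₁ v0 (idx-computable {m}))
                                        (app₁ v0 (arg-computable {m})) Gᶜ))
                     (λ z → G≡ (idx z) (arg {m} z))

      cases-reduction : IsManyOneReduction (autojoin m A) C cases
      cases-reduction = record
        { computable = cases-computable
        ; reduces    = λ z → ≤₁-reduces (F (idx z)) (arg {m} z)
            ⇔-∘ subst (λ w → w ∈ autojoin m A ⇔ arg {m} z ∈ A)
                      (⟨idx,arg⟩ z) (⇔-sym (⟨⟩-∈ (idx z) (arg {m} z)))
        }

    autojoin-least : Packing m A C → autojoin m A ≤₁ C
    autojoin-least (F , sep) = cases F , cases-reduction F , λ {x} {y} eq →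
      let i≡j = sep (idx x) (idx y) _ _ eq in
      idx-arg-injective i≡j
        (≤₁-injective (F (idx y)) (trans (cong (λ i → ≤₁-fun (F i) (arg {m} x)) (sym i≡j)) eq))

  autojoin-mono : ∀ {m n} .{{_ : NonZero m}} .{{_ : NonZero n}} →
                  A ≤₁ A′ → m ≤ n → autojoin m A ≤₁ autojoin n A′
  autojoin-mono F m≤n = autojoin-least
    (trans-packing F (packing-reindex (Fin.inject≤-injective m≤n m≤n _ _) autojoin-packing))

  autojoin-1 : autojoin 1 A ≤₁ A
  autojoin-1 = autojoin-least ((λ _ → ≤₁-refl) , λ { zero zero _ _ _ → refl })

  ≤₁-autojoin : ∀ m .{{_ : NonZero m}} → A ≤₁ autojoin m A
  ≤₁-autojoin m =
    ≤₁-trans (proj₁ (autojoin-packing {1}) zero) (autojoin-mono ≤₁-refl (>-nonZero⁻¹ m))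

  autojoin-+ : ∀ m n .{{_ : NonZero m}} .{{_ : NonZero n}} .{{_ : NonZero (m + n)}} →
               autojoin (m + n) A ≡₁ autojoin m A ⊕ autojoin n A
  autojoin-+ {A} m n = autojoin-least (F , sep) ,
    ⊕-least (autojoin-least (packing-reindex (Fin.↑ˡ-injective n _ _) autojoin-packing))
            (autojoin-least (packing-reindex (Fin.↑ʳ-injective m _ _) autojoin-packing))
            (λ x y eq → ↑ˡ≢↑ʳ (idx x) (idx y)
              (proj₂ (autojoin-packing {m + n} {A}) (idx x Fin.↑ˡ n) (m Fin.↑ʳ idx y) _ _ eq))
    where
    ↑ˡ≢↑ʳ : ∀ (i : Fin m) (j : Fin n) → i Fin.↑ˡ n ≢ m Fin.↑ʳ j
    ↑ˡ≢↑ʳ i j eq with () ←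
      trans (sym (Fin.splitAt-↑ˡ m i n)) (trans (cong (Fin.splitAt m) eq) (Fin.splitAt-↑ʳ m n j))
    G : Fin m ⊎ Fin n → A ≤₁ autojoin m A ⊕ autojoin n A
    G (inj₁ i) = ≤₁-trans (proj₁ autojoin-packing i) ≤₁-inl
    G (inj₂ j) = ≤₁-trans (proj₁ autojoin-packing j) ≤₁-inr
    G-sep : ∀ s t x y → ≤₁-fun (G s) x ≡ ≤₁-fun (G t) y → s ≡ t
    G-sep (inj₁ i) (inj₁ j) x y eq =
      cong inj₁ (proj₂ (autojoin-packing {m} {A}) i j x y (inl-injective eq))
    G-sep (inj₁ i) (inj₂ j) x y eq = contradiction eq inl≢inr
    G-sep (inj₂ i) (inj₁ j) x y eq = contradiction (sym eq) inl≢inr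
    G-sep (inj₂ i) (inj₂ j) x y eq =
      cong inj₂ (proj₂ (autojoin-packing {n} {A}) i j x y (inr-injective eq))
    F : Fin (m + n) → A ≤₁ autojoin m A ⊕ autojoin n A
    F = G ∘ Fin.splitAt m
    sep : ∀ i j x y → ≤₁-fun (F i) x ≡ ≤₁-fun (F j) y → i ≡ j
    sep i j x y eq = trans (sym (Fin.join-splitAt m n i))
      (trans (cong (Fin.join m n) (G-sep (Fin.splitAt m i) (Fin.splitAt m j) x y eq))
             (Fin.join-splitAt m n j))

  -- A copy inside a copy is indexed by a pair, and `combine` and `remQuot` identify pairs with
  -- elements of `Fin (m * n)`.
  autojoin-* : ∀ m n .{{_ : NonZero m}} .{{_ : NonZero n}} .{{_ : NonZero (m * n)}} →
               autojoin m (autojoin n A) ≡₁ autojoin (m * n) A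
  autojoin-* {A} m n =
    autojoin-least
      ( (λ i → autojoin-least (packing-reindex (Fin.combine-injectiveʳ i _ i _) autojoin-packing))
      , λ i j x y eq → Fin.combine-injectiveˡ i (idx x) j (idx y)
          (proj₂ (autojoin-packing {m * n} {A}) (Fin.combine i (idx x))
                 (Fin.combine j (idx y)) _ _ eq))
    , autojoin-least (F , sep)
    where
    G : Fin m × Fin n → A ≤₁ autojoin m (autojoin n A)
    G (i , j) = ≤₁-trans (proj₁ autojoin-packing j) (proj₁ autojoin-packing i)
    G-sep : ∀ p q x y → ≤₁-fun (G p) x ≡ ≤₁-fun (G q) y → p ≡ q
    G-sep (i , j) (k , l) x y eq with proj₂ (autojoin-packing {m} {autojoin n A}) i k _ _ eq
    ... | refl with proj₂ (autojoin-packing {n} {A}) j l x y (⟨⟩-injective i eq)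
    ...   | refl = refl
    F : Fin (m * n) → A ≤₁ autojoin m (autojoin n A)
    F i = G (Fin.remQuot n i)
    sep : ∀ i j x y → ≤₁-fun (F i) x ≡ ≤₁-fun (F j) y → i ≡ j
    sep i j x y eq = trans (sym (Fin.combine-remQuot {m} n i))
      (trans (cong (uncurry Fin.combine) (G-sep (Fin.remQuot n i) (Fin.remQuot n j) x y eq))
             (Fin.combine-remQuot {m} n j))

  -- The copies may all be mapped by the same reduction: they are split off one at a time, and
  -- gluing adds the fibre bounds.
  autojoin-bfo : ∀ m .{{_ : NonZero m}} → A ≤bfo C → autojoin m A ≤bfo C
  autojoin-bfo (suc zero)    F = ≤₁-≤bfo-trans autojoin-1 F
  autojoin-bfo (suc (suc m)) F = ≤₁-≤bfo-trans (proj₁ (autojoin-+ 1 (suc m)))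
    (⊕-least-bfo (autojoin-bfo 1 F) (autojoin-bfo (suc m) F))

  -- Cancellation

  -- A walk sits at a point of B ⊕ C; from an occupied point y of B it goes on
  -- from the user of y, and from a point of C it goes on inside A ⊕ C, unless
  -- the reduction of C to B finds a free value there.
  ⊕-cancelʳ : A ⊕ C ≤₁ B ⊕ C → C ≤bfo B → A ≤₁ B
  ⊕-cancelʳ {A} {C} {B} F (h , H , b , _ , h-fibres) =
    -- A value y in the range of `cand` is offered by `inl y` and by the at most b points that `h`
    -- sends to y.
    Greedy.greedy-reduction (1 + b) cand (f ∘ inl) next
      (join-computable id h id-computable H.computable)
      (∘-computable inl-computable (≤₁-computable F))
      next-computable
      (join-fibres id h (injective-fibres id) h-fibres)
      init-colour
      (λ s u → next-colour (side s))
      (λ s s′ u u′ → next-injective (side s) (side s′))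
      (λ s u x → next≢init (side s))
    where
    module H = IsManyOneReduction H
    f : ℕ → ℕ
    f = ≤₁-fun F
    cand : ℕ → ℕ
    cand = join id h
    next : ℕ → ℕ → ℕ
    next s u = join (λ _ → f (inl u)) (f ∘ inr) s
    next-computable : Computable₂ (uncurry next)
    next-computable = computable₂
      (app₃ (app₁ v0 (idx-computable {2}))
            (app₁ (app₁ v1 inl-computable) (≤₁-computable F))
            (app₁ (app₁ (app₁ v0 (arg-computable {2})) inr-computable) (≤₁-computable F))
            if0-computable)
    cand-reduces : ∀ z → z ∈ B ⊕ C ⇔ cand z ∈ B
    cand-reduces = IsManyOneReduction.reduces (join-reduction id h (≤₁-reduction ≤₁-refl) H)
    f-colour : ∀ z → z ∈ A ⊕ C ⇔ cand (f z) ∈ B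
    f-colour z = cand-reduces (f z) ⇔-∘ ≤₁-reduces F z
    init-colour : ∀ x → x ∈ A ⇔ cand (f (inl x)) ∈ B
    init-colour x = f-colour (inl x) ⇔-∘ inl-∈ x
    next-inl : ∀ y u → next (inl y) u ≡ f (inl u)
    next-inl y u = join-inl (λ _ → f (inl u)) (f ∘ inr) y
    next-inr : ∀ c u → next (inr c) u ≡ f (inr c)
    next-inr c u = join-inr (λ _ → f (inl u)) (f ∘ inr) c
    next-colour : ∀ {s u} → Side s → u ∈ A ⇔ cand s ∈ B → cand s ∈ B ⇔ cand (next s u) ∈ B
    next-colour {u = u} (left y) u⇔y =
      subst (λ t → cand (inl y) ∈ B ⇔ cand t ∈ B) (sym (next-inl y u))
            (init-colour u ⇔-∘ ⇔-sym u⇔y)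
    next-colour {u = u} (right c) _ =
      subst (λ t → cand (inr c) ∈ B ⇔ cand t ∈ B) (sym (next-inr c u))
            (f-colour (inr c) ⇔-∘ (inr-∈ c ⇔-∘
             subst (λ y → y ∈ B ⇔ c ∈ C) (sym (join-inr id h c)) (⇔-sym (H.reduces c))))
    next-injective : ∀ {s s′ u u′} → Side s → Side s′ → (u ≡ u′ → cand s ≡ cand s′) →
                     next s u ≡ next s′ u′ → s ≡ s′
    -- Injectivity of `f` makes the users equal, and the candidate of `inl y` is y itself, so `same`
    -- gives equality of y and y′.
    next-injective {u = u} {u′} (left y) (left y′) same eq = cong inl
      (trans (sym (join-inl id h y)) (trans (same (inl-injective (≤₁-injective F
        (trans (sym (next-inl y u)) (trans eq (next-inl y′ u′)))))) (join-inl id h y′)))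
    next-injective {u = u} {u′} (left y) (right c) _ eq = contradiction
      (≤₁-injective F (trans (sym (next-inl y u)) (trans eq (next-inr c u′)))) inl≢inr
    next-injective {u = u} {u′} (right c) (left y) _ eq = contradiction
      (≤₁-injective F (trans (sym (next-inl y u′)) (trans (sym eq) (next-inr c u)))) inl≢inr
    next-injective {u = u} {u′} (right c) (right c′) _ eq =
      ≤₁-injective F (trans (sym (next-inr c u)) (trans eq (next-inr c′ u′)))
    next≢init : ∀ {s u x} → Side s → u ≢ x → next s u ≢ f (inl x)
    next≢init {u = u} (left y) u≢x eq =
      u≢x (inl-injective (≤₁-injective F (trans (sym (next-inl y u)) eq)))
    next≢init {u = u} (right c) _ eq =
      inl≢inr (sym (≤₁-injective F (trans (sym (next-inr c u)) eq)))

  -- Cylinders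

  -- `pairing` comes with a code for its forward direction; the inverse is computed by searching
  -- through the Cantor codes w of pairs, which makes it a search over one variable.
  decode-exists : ∀ z → Zero (λ w → δ ⟨ π₁ w , π₂ w ⟩ z)
  decode-exists z with (a , b) , onto ← Bijection.strictlySurjective pairing z =
    pair a b , δ≡0 (trans (cong₂ ⟨_,_⟩ (π₁-pair a b) (π₂-pair a b)) onto)

  decode : ℕ → ℕ
  decode z = μ (λ w → δ ⟨ π₁ w , π₂ w ⟩ z) (decode-exists z)

  fstᶜ : ℕ → ℕ
  fstᶜ z = π₁ (decode z)

  fstᶜ-computable : Computable fstᶜ
  fstᶜ-computable = computable₁
    (app₁ (μᵛ (app₂ (app₂ (app₁ v0 π₁-computable) (app₁ v0 π₂-computable) pairing-computable)
                    v1 δ-computable)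
              λ { (z ∷ []) → decode-exists z })
          π₁-computable)

  ∈-Cyl : ∀ z → z ∈ Cyl A ⇔ fstᶜ z ∈ A
  ∈-Cyl {A} z = mk⇔
    (λ { (x , t , x∈A , eq) →
         subst A (sym (cong proj₁ (Bijection.injective pairing (trans decoded eq)))) x∈A })
    (λ a∈A → fstᶜ z , π₂ (decode z) , a∈A , sym decoded)
    where
    decoded : ⟨ fstᶜ z , π₂ (decode z) ⟩ ≡ z
    decoded = δ≡0⇒≡ _ z (μ-zero (λ w → δ ⟨ π₁ w , π₂ w ⟩ z) (decode-exists z))

  ≤₁-Cyl : A ≤₁ Cyl A
  ≤₁-Cyl {A} = ⟨_, 0 ⟩
    , record
      { computable = computable₁ (app₂ v0 (litᵛ 0) pairing-computable)
      ; reduces    = λ x → mk⇔ (λ x∈A → x , 0 , x∈A , refl)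
          λ { (y , t , y∈A , eq) → subst A (sym (cong proj₁ (Bijection.injective pairing eq))) y∈A }
      }
    , λ eq → cong proj₁ (Bijection.injective pairing eq)

  -- Hilbert's hotel: the copies of E pushed down by iterating C ⊕ E ≤₁ C make
  -- room for infinitely many copies of A.
  hotel⇒IsCylinder : ∀ {E} → C ⊕ E ≤₁ C → C ≤bfo A → A ≤bfo E → IsCylinder A
  hotel⇒IsCylinder {C} {A} {E} F (h , H , b , _ , h-fibres) (k , K , _) =
    ≤₁-Cyl , Greedy.greedy-reduction b h init (λ s _ → f (inl s))
      H.computable
      (∘-computable fstᶜ-computable (∘-computable K.computable
        (∘-computable inr-computable (≤₁-computable F))))
      (computable₂ (app₁ (app₁ v0 inl-computable) (≤₁-computable F)))
      h-fibres
      (λ z → f-colour _ ⇔-∘ (inr-∈ _ ⇔-∘ (K.reduces _ ⇔-∘ ∈-Cyl z)))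
      (λ s u _ → f-colour _ ⇔-∘ (inl-∈ s ⇔-∘ ⇔-sym (H.reduces s)))
      (λ s s′ u u′ _ eq → inl-injective (≤₁-injective F eq))
      (λ s u x _ eq → inl≢inr (≤₁-injective F eq))
    where
    module H = IsManyOneReduction H
    module K = IsManyOneReduction K
    f : ℕ → ℕ
    f = ≤₁-fun F
    -- Many points of the cylinder may start at the same state; occupied values push the later ones
    -- further along the orbit of `f ∘ inl`. Starting states lie in the image of `f ∘ inr`, so no
    -- orbit returns to one.
    init : ℕ → ℕ
    init z = f (inr (k (fstᶜ z)))
    f-colour : ∀ z → z ∈ C ⊕ E ⇔ h (f z) ∈ A
    f-colour z = H.reduces (f z) ⇔-∘ ≤₁-reduces F z

  -- Splitting along decidable sets

  ⇔⇒≤₁ : (∀ x → x ∈ A ⇔ x ∈ B) → A ≤₁ B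
  ⇔⇒≤₁ A⇔B = id , record { computable = id-computable ; reduces = A⇔B } , id

  -- Injectivity of `f` is asked for on the zeros of `χ` alone: this admits a finite-one map
  -- restricted to a set on which it is injective.
  if0-≤₁ : ∀ {χ f g} → Computable χ → Computable f → Computable g →
           (∀ {x y} → χ x ≡ 0 → χ y ≡ 0 → f x ≡ f y → x ≡ y) → Injective _≡_ _≡_ g →
           (∀ {x y} → χ x ≡ 0 → f x ≢ g y) →
           (∀ {x} → χ x ≡ 0 → x ∈ A ⇔ f x ∈ C) → (∀ {x} → χ x ≢ 0 → x ∈ A ⇔ g x ∈ C) →
           A ≤₁ C
  if0-≤₁ {A} {C} {χ} {f} {g} χᶜ fᶜ gᶜ f-inj g-inj f≢g f-colour g-colour = h
    , record
      { computable = computable₁ (app₃ (app₁ v0 χᶜ) (app₁ v0 fᶜ) (app₁ v0 gᶜ) if0-computable)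
      ; reduces    = colour
      }
    , λ {x} {y} → injective x y
    where
    h : ℕ → ℕ
    h x = if0 (χ x) (f x) (g x)
    colour : ∀ x → x ∈ A ⇔ h x ∈ C
    colour x with χ x | f-colour {x} | g-colour {x}
    ... | zero  | fᶜᵒ | _   = fᶜᵒ refl
    ... | suc _ | _   | gᶜᵒ = gᶜᵒ λ ()
    injective : ∀ x y → h x ≡ h y → x ≡ y
    injective x y eq with χ x in χx | χ y in χy
    ... | zero  | zero  = f-inj χx χy eq
    ... | zero  | suc _ = contradiction eq (f≢g χx)
    ... | suc _ | zero  = contradiction (sym eq) (f≢g χy)
    ... | suc _ | suc _ = g-inj eq

  -- Making room inside a computable reservoir

  module Reservoir {R₀ : Pred ℕ 0ℓ} (χ : ℕ → ℕ) (χ-computable : Computable χ)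
    (χ-decides : ∀ x → (x ∈ R₀ × χ x ≡ 1) ⊎ (x ∉ R₀ × χ x ≡ 0)) (R₀-infinite : Infinite R₀) where

    χ≡1⇒∈ : ∀ {x} → χ x ≡ 1 → x ∈ R₀
    χ≡1⇒∈ {x} eq = [ proj₁ , (λ p → contradiction (trans (sym eq) (proj₂ p)) λ ()) ]′ (χ-decides x)

    χ≡0⇒∉ : ∀ {x} → χ x ≡ 0 → x ∉ R₀
    χ≡0⇒∉ {x} eq = [ (λ p → contradiction (trans (sym eq) (proj₂ p)) λ ()) , proj₁ ]′ (χ-decides x)

    χ≢0⇒∈ : ∀ {x} → χ x ≢ 0 → x ∈ R₀
    χ≢0⇒∈ {x} neq = [ proj₁ , (λ p → contradiction (proj₂ p) neq) ]′ (χ-decides x)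

    ∈⇒χ≡1 : ∀ {x} → x ∈ R₀ → χ x ≡ 1
    ∈⇒χ≡1 {x} x∈R = [ proj₂ , (λ p → contradiction x∈R (proj₁ p)) ]′ (χ-decides x)

    next-exists : ∀ b → Zero (λ d → δ (χ (b + d)) 1)
    next-exists b with x , b≤x , x∈R ← R₀-infinite b =
      x ∸ b , δ≡0 (trans (cong χ (m+[n∸m]≡n b≤x)) (∈⇒χ≡1 x∈R))

    abstract
      next : ℕ → ℕ
      next b = b + μ (λ d → δ (χ (b + d)) 1) (next-exists b)

      next-∈ : ∀ b → next b ∈ R₀
      next-∈ b = χ≡1⇒∈ (δ≡0⇒≡ _ 1 (μ-zero (λ d → δ (χ (b + d)) 1) (next-exists b)))

      next-computable : Computable next
      next-computable = computable₁ (app₂ v0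
        (μᵛ (app₂ (app₁ (app₂ v1 v0 +-computable) χ-computable) (litᵛ 1) δ-computable)
            λ { (b ∷ []) → next-exists b })
        +-computable)

      -- The increasing enumeration of the reservoir, since `next b` is its least member from b on.
      enum : ℕ → ℕ
      enum = natrec (next 0) (λ _ r → next (suc r))

      enum-computable : Computable enum
      enum-computable = computable₁
        (recᵛ (app₁ (litᵛ 0) next-computable) (app₁ (app₁ v1 suc-computable) next-computable) v0)

      enum-∈ : ∀ n → enum n ∈ R₀
      enum-∈ zero    = next-∈ 0
      enum-∈ (suc n) = next-∈ (suc (enum n))

      enum-mono-< : ∀ {m n} → m < n → enum m < enum n
      enum-mono-< {m} {suc n} m<1+n = ≤-trans
        (s≤s ([ (λ m<n → <⇒≤ (enum-mono-< m<n)) , (λ m≡n → ≤-reflexive (cong enum m≡n)) ]′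
              (m≤n⇒m<n∨m≡n (≤-pred m<1+n))))
        (m≤m+n (suc (enum n)) _)

    enum-injective : Injective _≡_ _≡_ enum
    enum-injective {m} {n} eq with <-cmp m n
    ... | tri< m<n _ _ = contradiction eq (<⇒≢ (enum-mono-< m<n))
    ... | tri≈ _ m≡n _ = m≡n
    ... | tri> _ _ n<m = contradiction (sym eq) (<⇒≢ (enum-mono-< n<m))

    -- The points of the reservoir retreat to its members of even index, all other points stay, and
    -- the members of odd index receive the empty summand. Colours are kept, since the reservoir
    -- lies outside A.
    ⊕-∅-≤₁ : R₀ ⊆ ∁ A → A ⊕ ∅ ≤₁ A
    ⊕-∅-≤₁ {A} R₀⊆∁A = ⊕-least evens odds disjoint
      where
      double-computable : Computable (2 *_)
      double-computable = computable₁ (app₂ (litᵛ 2) v0 *-computable)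
      evens : A ≤₁ A
      evens = if0-≤₁ χ-computable id-computable (∘-computable double-computable enum-computable)
        (λ _ _ → id)
        (λ eq → *-cancelˡ-≡ _ _ 2 (enum-injective eq))
        (λ { χ≡0 refl → χ≡0⇒∉ χ≡0 (enum-∈ _) })
        (λ _ → ⇔-id _)
        (λ χ≢0 → mk⇔ (λ x∈A → contradiction x∈A (R₀⊆∁A (χ≢0⇒∈ χ≢0)))
                     (λ e∈A → contradiction e∈A (R₀⊆∁A (enum-∈ _))))
      odds : ∅ ≤₁ A
      odds = (λ x → enum (suc (2 * x)))
        , record
          { computable = ∘-computable (∘-computable double-computable suc-computable)
                                       enum-computable
          ; reduces    = λ x → mk⇔ (λ ()) (λ e∈A → contradiction e∈A (R₀⊆∁A (enum-∈ _)))
          }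
        , λ eq → *-cancelˡ-≡ _ _ 2 (suc-injective (enum-injective eq))
      disjoint : Disjoint evens odds
      disjoint x y eq with χ x in χx
      ... | zero  = χ≡0⇒∉ χx (subst R₀ (sym eq) (enum-∈ _))
      ... | suc _ = even≢odd x y (enum-injective eq)

  -- Ranks within the fibres of a bounded finite-one map

  module Fibres {f : ℕ → ℕ} {b : ℕ}
    (f-computable : Computable f) (f-fibres : FibresBoundedBy b f) where

    count : ℕ → ℕ → ℕ
    count v = natrec 0 (λ z r → if0 (δ (f z) v) (suc r) r)

    -- The position of x in its fibre, that is, the number of smaller points with the same value.
    rank : ℕ → ℕ
    rank x = count (f x) x

    rank-computable : Computable rank
    rank-computable = computable₁
      (recᵛ (litᵛ 0)
        (app₃ (app₂ (app₁ v0 f-computable) (app₁ v2 f-computable) δ-computable)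
              (app₁ v1 suc-computable) v1 if0-computable)
        v0)

    count-step : ∀ v i → count v i ≤ count v (suc i)
    count-step v i with δ (f i) v
    ... | zero  = n≤1+n _
    ... | suc _ = ≤-refl

    count-mono : ∀ v i d → count v i ≤ count v (d + i)
    count-mono v i zero    = ≤-refl
    count-mono v i (suc d) = ≤-trans (count-mono v i d) (count-step v (d + i))

    count-hit : ∀ x → count (f x) (suc x) ≡ suc (rank x)
    count-hit x = if0-zero (δ≡0 {f x} refl)

    rank-mono-< : ∀ {x y} → f x ≡ f y → x < y → rank x < rank y
    rank-mono-< {x} {y} fx≡fy x<y = begin
      suc (rank x)                        ≡⟨ count-hit x ⟨
      count (f x) (suc x)                 ≤⟨ count-mono (f x) (suc x) (y ∸ suc x) ⟩
      count (f x) (y ∸ suc x + suc x)     ≡⟨ cong₂ count fx≡fy (m∸n+n≡m x<y) ⟩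
      rank y                              ∎
      where open ≤-Reasoning

    rank-injective : ∀ {x y} → f x ≡ f y → rank x ≡ rank y → x ≡ y
    rank-injective {x} {y} fx≡fy eq with <-cmp x y
    ... | tri< x<y _ _ = contradiction eq (<⇒≢ (rank-mono-< fx≡fy x<y))
    ... | tri≈ _ x≡y _ = x≡y
    ... | tri> _ _ y<x = contradiction (sym eq) (<⇒≢ (rank-mono-< (sym fx≡fy) y<x))

    -- `FibresBoundedBy` speaks of lists, so the points counted by `count` have to be listed before
    -- it applies.
    preimages : ∀ v i → ∃[ xs ] Unique xs × All (λ x → x < i × f x ≡ v) xs × length xs ≡ count v i
    preimages v zero = [] , AllPairs.[] , All.[] , refl
    preimages v (suc i) with preimages v i | δ (f i) v in δ-eq
    ... | xs , xs! , xs↦v , len | suc _ =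
      xs , xs! , All.map (λ { (x<i , eq) → m<n⇒m<1+n x<i , eq }) xs↦v , len
    ... | xs , xs! , xs↦v , len | zero  =
      i ∷ xs
      , All.map (λ { (x<i , _) refl → <-irrefl refl x<i }) xs↦v AllPairs.∷ xs!
      , (≤-refl , δ≡0⇒≡ (f i) v δ-eq) All.∷ All.map (λ { (x<i , eq) → m<n⇒m<1+n x<i , eq }) xs↦v
      , cong suc len

    -- The count up to `suc x` includes x itself, which makes the bound strict.
    rank<b : ∀ x → rank x < b
    rank<b x with xs , xs! , xs↦ , len ← preimages (f x) (suc x) =
      subst (_≤ b) (trans len (count-hit x)) (f-fibres (f x) xs xs! (All.map proj₂ xs↦))

    Below At : Pred ℕ 0ℓ → ℕ → Pred ℕ 0ℓ
    Below B j x = x ∈ B × rank x < j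
    At    B j x = x ∈ B × rank x ≡ j

    module _ (j : ℕ) where
      below? at? : ℕ → ℕ
      below? x = suc (rank x) ∸ j
      at?    x = δ (rank x) j

      below?-computable : Computable below?
      below?-computable = computable₁
        (app₂ (app₁ (app₁ v0 rank-computable) suc-computable) (litᵛ j) ∸-computable)

      at?-computable : Computable at?
      at?-computable = computable₁ (app₂ (app₁ v0 rank-computable) (litᵛ j) δ-computable)

      at?≡0 : ∀ x → at? x ≡ 0 → rank x ≡ j
      at?≡0 x = δ≡0⇒≡ (rank x) j

      at?≢0 : ∀ x → at? x ≢ 0 → rank x ≢ j
      at?≢0 x neq eq = neq (δ≡0 eq)

      below?≡0 : ∀ x → below? x ≡ 0 → rank x < j
      below?≡0 x = m∸n≡0⇒m≤n

      below?≢0 : ∀ x → below? x ≢ 0 → ¬ rank x < j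
      below?≢0 x neq lt = neq (m≤n⇒m∸n≡0 lt)

      -- On the points of rank j the map `f` is injective; all other points lie outside `At B j` and
      -- go to the empty summand.
      At-≤₁ : (∀ x → x ∈ B ⇔ f x ∈ C) → At B j ≤₁ C ⊕ ∅
      At-≤₁ B⇔C = if0-≤₁ at?-computable (∘-computable f-computable inl-computable) inr-computable
        (λ {x} {y} x≡ y≡ eq → rank-injective
          (inl-injective eq) (trans (at?≡0 x x≡) (sym (at?≡0 y y≡))))
        inr-injective
        (λ _ → inl≢inr)
        (λ {x} x≡ → inl-∈ (f x) ⇔-∘ (B⇔C x ⇔-∘ mk⇔ proj₁ (_, at?≡0 x x≡)))
        (λ {x} x≢ → inr-∈ x ⇔-∘ mk⇔ (λ { (_ , eq) → contradiction eq (at?≢0 x x≢) }) (λ ()))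

      Below-suc-≤₁ : Below B (suc j) ≤₁ Below B j ⊕ At B j
      Below-suc-≤₁ = if0-≤₁ below?-computable inl-computable inr-computable
        (λ _ _ → inl-injective) inr-injective (λ _ → inl≢inr)
        (λ {x} x≡ → inl-∈ x ⇔-∘ mk⇔ (λ { (x∈B , _) → x∈B , below?≡0 x x≡ })
                                     (λ { (x∈B , lt) → x∈B , m<n⇒m<1+n lt }))
        (λ {x} x≢ → inr-∈ x ⇔-∘ mk⇔
          (λ { (x∈B , lt) → x∈B , ≤-antisym (≤-pred lt) (≮⇒≥ (below?≢0 x x≢)) })
          (λ { (x∈B , eq) → x∈B , s≤s (≤-reflexive eq) }))

      -- Every number occurs on both sides of the join. On each side the numbers of the wrong rank
      -- are parked in the empty summand, in two copies of ℕ that are disjoint from each other.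
      ≤₁-Below-suc : Below B j ⊕ At B j ≤₁ Below B (suc j) ⊕ ∅
      ≤₁-Below-suc {B} = ⊕-least below at disjoint
        where
        below : Below B j ≤₁ Below B (suc j) ⊕ ∅
        below = if0-≤₁ below?-computable inl-computable (∘-computable inl-computable inr-computable)
          (λ _ _ → inl-injective)
          (λ eq → inl-injective (inr-injective eq))
          (λ _ → inl≢inr)
          (λ {x} x≡ → inl-∈ x ⇔-∘ mk⇔ (λ { (x∈B , lt) → x∈B , m<n⇒m<1+n lt })
                                       (λ { (x∈B , _) → x∈B , below?≡0 x x≡ }))
          (λ {x} x≢ → inr-∈ (inl x) ⇔-∘ mk⇔
            (λ { (_ , lt) → contradiction lt (below?≢0 x x≢) }) (λ ()))
        at : At B j ≤₁ Below B (suc j) ⊕ ∅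
        at = if0-≤₁ at?-computable inl-computable (∘-computable inr-computable inr-computable)
          (λ _ _ → inl-injective)
          (λ eq → inr-injective (inr-injective eq))
          (λ _ → inl≢inr)
          (λ {x} x≡ → inl-∈ x ⇔-∘ mk⇔ (λ { (x∈B , eq) → x∈B , s≤s (≤-reflexive eq) })
                                       (λ { (x∈B , _) → x∈B , at?≡0 x x≡ }))
          (λ {x} x≢ → inr-∈ (inr x) ⇔-∘ mk⇔ (λ { (_ , eq) → contradiction eq (at?≢0 x x≢) }) (λ ()))
        disjoint : Disjoint below at
        disjoint x y eq with below? x in below-x | at? y in at-y
        ... | zero  | zero  with refl ← inl-injective eq =
          <⇒≢ (below?≡0 x below-x) (at?≡0 x at-y)
        ... | zero  | suc _ = inl≢inr eq
        ... | suc _ | zero  = inl≢inr (sym eq)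
        ... | suc _ | suc _ = inl≢inr (inr-injective eq)

  -- Towers

  2^≢0 : ∀ k → NonZero (2 ^ k)
  2^≢0 k = m^n≢0 2 k

  module Tower (U : ℕ → Pred ℕ 0ℓ) (tower : WeakDyadicTower U) where

    multiple : (m : ℕ) .(m≢0 : NonZero m) → ℕ → Pred ℕ 0ℓ
    multiple m m≢0 n = autojoin m {{m≢0}} (U n)

    tower^ : ∀ k n → U n ≡₁ multiple (2 ^ k) (2^≢0 k) (k + n)
    tower^ zero    n = ≤₁-autojoin 1 , autojoin-1
    tower^ (suc k) n = ≡₁-trans (tower^ k n)
      ( ≤₁-trans (autojoin-mono (proj₁ (tower (k + n))) ≤-refl)
          (≤₁-trans (proj₁ (autojoin-* (2 ^ k) 2))
            (autojoin-mono ≤₁-refl (≤-reflexive (*-comm (2 ^ k) 2))))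
      , ≤₁-trans (autojoin-mono ≤₁-refl (≤-reflexive (*-comm 2 (2 ^ k))))
          (≤₁-trans (proj₂ (autojoin-* (2 ^ k) 2)) (autojoin-mono (proj₂ (tower (k + n))) ≤-refl))
      )
      where
      instance
        _ : NonZero (2 ^ k)
        _ = 2^≢0 k
        _ : NonZero (2 ^ suc k)
        _ = 2^≢0 (suc k)
        _ : NonZero (2 ^ k * 2)
        _ = m*n≢0 (2 ^ k) 2

    base-multiple : ∀ n → U 0 ≡₁ multiple (2 ^ n) (2^≢0 n) n
    base-multiple n = subst (λ i → U 0 ≡₁ multiple (2 ^ n) (2^≢0 n) i) (+-identityʳ n) (tower^ n 0)

    ≤₁-base : ∀ n → U n ≤₁ U 0
    ≤₁-base n = ≤₁-trans (≤₁-autojoin (2 ^ n) {{2^≢0 n}}) (proj₂ (base-multiple n))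

    multiple-≤bfo-base : ∀ m (m≢0 : NonZero m) n → multiple m m≢0 n ≤bfo U 0
    multiple-≤bfo-base m m≢0 n = autojoin-bfo m {{m≢0}} (≤₁⇒≤bfo (≤₁-base n))

    -- `U 0` is made of finitely many copies of `U n`, and all of them can be sent through the same
    -- reduction.
    ≤₁⇒base-≤bfo : ∀ n → U n ≤₁ B → U 0 ≤bfo B
    ≤₁⇒base-≤bfo n F = ≤₁-≤bfo-trans (proj₁ (base-multiple n))
      (autojoin-bfo (2 ^ n) {{2^≢0 n}} (≤₁⇒≤bfo F))

    base-≤bfo-multiple : ∀ m (m≢0 : NonZero m) n → U 0 ≤bfo multiple m m≢0 n
    base-≤bfo-multiple m m≢0 n = ≤₁⇒base-≤bfo n (≤₁-autojoin m {{m≢0}})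

    *2^≢0 : ∀ {m} k → NonZero m → NonZero (m * 2 ^ k)
    *2^≢0 {m} k m≢0 = m*n≢0 m (2 ^ k) {{m≢0}} {{2^≢0 k}}

    -- The counterpart of expanding the fraction m / 2ⁿ by 2ᵏ.
    raise : ∀ m (m≢0 : NonZero m) k n →
            multiple m m≢0 n ≡₁ multiple (m * 2 ^ k) (*2^≢0 k m≢0) (k + n)
    raise m m≢0 k n = ≡₁-trans
      (autojoin-mono (proj₁ (tower^ k n)) ≤-refl , autojoin-mono (proj₂ (tower^ k n)) ≤-refl)
      (autojoin-* m (2 ^ k))
      where
      instance
        _ : NonZero m
        _ = m≢0
        _ : NonZero (2 ^ k)
        _ = 2^≢0 k
        _ : NonZero (m * 2 ^ k)
        _ = *2^≢0 k m≢0

    raise′ : ∀ m (m≢0 : NonZero m) k n →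
             multiple m m≢0 k ≡₁ multiple (m * 2 ^ n) (*2^≢0 n m≢0) (k + n)
    raise′ m m≢0 k n =
      subst (λ i → multiple m m≢0 k ≡₁ multiple (m * 2 ^ n) (*2^≢0 n m≢0) i)
            (+-comm n k) (raise m m≢0 n k)

    respects : A ≡₁ B → IsAutojoinOfMember U A → IsAutojoinOfMember U B
    respects (A≤B , B≤A) (m , n , m≢0 , A≡) = m , n , m≢0 , ≡₁-trans (B≤A , A≤B) A≡

    -- At the common level n + n′ copies add up as numerators do over a common denominator.
    ⊕-closed : IsAutojoinOfMember U A → IsAutojoinOfMember U B → IsAutojoinOfMember U (A ⊕ B)
    ⊕-closed (m , n , m≢0 , A≡) (m′ , n′ , m′≢0 , B≡) =
      p + q , n + n′ , p+q≢0 , ≡₁-trans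
        (⊕-mono (proj₁ A≡′) (proj₁ B≡′) , ⊕-mono (proj₂ A≡′) (proj₂ B≡′))
        (let to , from = autojoin-+ p q {{*2^≢0 n′ m≢0}} {{*2^≢0 n m′≢0}} {{p+q≢0}} in from , to)
      where
      p q : ℕ
      p = m * 2 ^ n′
      q = m′ * 2 ^ n
      p+q≢0 : NonZero (p + q)
      p+q≢0 = >-nonZero (≤-trans (>-nonZero⁻¹ p {{*2^≢0 n′ m≢0}}) (m≤m+n p q))
      A≡′ = ≡₁-trans A≡ (raise′ m m≢0 n n′)
      B≡′ = ≡₁-trans B≡ (raise m′ m′≢0 n n′)

    module _ (¬cylinder : ¬ IsCylinder (U 0)) where

      -- If m′ < m, then m′ copies of `U n` would absorb one more, and Hilbert's hotel would make
      -- `U 0` a cylinder.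
      multiple-cancel-≤ : ∀ m m′ (m≢0 : NonZero m) (m′≢0 : NonZero m′) n →
                          multiple m m≢0 n ≤₁ multiple m′ m′≢0 n → m ≤ m′
      multiple-cancel-≤ m m′ m≢0 m′≢0 n F = ≮⇒≥ λ m′<m → ¬cylinder
        (hotel⇒IsCylinder
          (≤₁-trans (⊕-mono ≤₁-refl (≤₁-autojoin 1))
            (≤₁-trans (proj₂ (autojoin-+ m′ 1))
              (≤₁-trans (autojoin-mono ≤₁-refl (≤-trans (≤-reflexive (+-comm m′ 1)) m′<m)) F)))
          (multiple-≤bfo-base m′ m′≢0 n)
          (≤₁⇒base-≤bfo n ≤₁-refl))
        where
        instance
          _ : NonZero m
          _ = m≢0
          _ : NonZero m′
          _ = m′≢0
          _ : NonZero (m′ + 1)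
          _ = >-nonZero (m≤n+m 1 m′)

      multiple-≤₁⇔ : ∀ m m′ (m≢0 : NonZero m) (m′≢0 : NonZero m′) n n′ →
                     multiple m m≢0 n ≤₁ multiple m′ m′≢0 n′ ⇔ m * 2 ^ n′ ≤ m′ * 2 ^ n
      multiple-≤₁⇔ m m′ m≢0 m′≢0 n n′ = mk⇔
        (λ F → multiple-cancel-≤ _ _ (*2^≢0 n′ m≢0) (*2^≢0 n m′≢0) (n + n′)
          (≤₁-trans (proj₂ up) (≤₁-trans F (proj₁ up′))))
        (λ le → ≤₁-trans (proj₁ up) (≤₁-trans
          (autojoin-mono {{*2^≢0 n′ m≢0}} {{*2^≢0 n m′≢0}} ≤₁-refl le) (proj₂ up′)))
        where
        up  = raise′ m m≢0 n n′
        up′ = raise m′ m′≢0 n n′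

      subtract-base : U 0 ≤bfo B → IsAutojoinOfMember U (B ⊕ U 0) → IsAutojoinOfMember U B
      subtract-base {B} U≤B (m , n , m≢0 , ⊕≤m , m≤⊕) with 2 ^ n <? m
      -- With at most 2ⁿ copies altogether, `U 0` would absorb B, and `U≤B` makes B large enough to
      -- serve as the guests of the hotel.
      ... | no q≮m = contradiction
        (hotel⇒IsCylinder
          (≤₁-trans ⊕-comm (≤₁-trans ⊕≤m (≤₁-trans
            (autojoin-mono {{m≢0}} {{2^≢0 n}} ≤₁-refl (≮⇒≥ q≮m)) (proj₂ (base-multiple n)))))
          (≤₁⇒≤bfo ≤₁-refl) U≤B)
        ¬cylinder
      -- `U 0` is 2ⁿ copies of `U n`, so m - 2ⁿ copies remain. The summand `U 0` is cancelled once
      -- against these and once against B, both of which it reduces to by a bounded finite-one map.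
      ... | yes q<m = r , n , r≢0
        , ⊕-cancelʳ (≤₁-trans ⊕≤m (≤₁-trans split (⊕-mono ≤₁-refl (proj₂ (base-multiple n)))))
                    (base-≤bfo-multiple r r≢0 n)
        , ⊕-cancelʳ (≤₁-trans (⊕-mono ≤₁-refl (proj₁ (base-multiple n))) (≤₁-trans unsplit m≤⊕)) U≤B
        where
        r : ℕ
        r = m ∸ 2 ^ n
        r≢0 : NonZero r
        r≢0 = >-nonZero (m<n⇒0<n∸m q<m)
        m≡r+q : m ≡ r + 2 ^ n
        m≡r+q = sym (m∸n+n≡m (<⇒≤ q<m))
        instance
          _ : NonZero m
          _ = m≢0
          _ : NonZero (2 ^ n)
          _ = 2^≢0 n
          _ : NonZero r
          _ = r≢0
          _ : NonZero (r + 2 ^ n)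
          _ = subst NonZero m≡r+q m≢0
        split : multiple m m≢0 n ≤₁ multiple r r≢0 n ⊕ multiple (2 ^ n) (2^≢0 n) n
        split = ≤₁-trans (autojoin-mono ≤₁-refl (≤-reflexive m≡r+q)) (proj₁ (autojoin-+ r (2 ^ n)))
        unsplit : multiple r r≢0 n ⊕ multiple (2 ^ n) (2^≢0 n) n ≤₁ multiple m m≢0 n
        unsplit = ≤₁-trans (proj₂ (autojoin-+ r (2 ^ n)))
                           (autojoin-mono ≤₁-refl (≤-reflexive (sym m≡r+q)))

      module _ (U⊕∅≤U : U 0 ⊕ ∅ ≤₁ U 0) (absorbs : BaseAbsorption (U 0) U) where

        classify : ∀ B → B ≡bfo U 0 → IsAutojoinOfMember U B
        classify B ((f , F , b , _ , f-fibres) , U≤B) =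
          -- Every rank is below b, so `Below B b` is B itself.
          subtract-base U≤B (respects
            ( ≤₁-trans ⊕-comm (⊕-mono (⇔⇒≤₁ λ x → mk⇔ proj₁ (_, rank<b x)) ≤₁-refl)
            , ≤₁-trans ⊕-comm (⊕-mono ≤₁-refl (⇔⇒≤₁ λ x → mk⇔ (_, rank<b x) proj₁)))
            (below b))
          where
          open Fibres (IsManyOneReduction.computable F) f-fibres
          below : ∀ j → IsAutojoinOfMember U (U 0 ⊕ Below B j)
          below zero    = absorbs _
            (≤₁-trans (⇔⇒≤₁ λ x → mk⇔ (λ ()) (λ ())) (≤₁-trans ≤₁-inr U⊕∅≤U))
          -- The new piece arrives with a second copy of `U 0`: (U ⊕ Below j) ⊕ (U ⊕ At j) is
          -- rearranged into (U ⊕ Below (j + 1)) ⊕ U. The second copy takes in the empty summand on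
          -- the way and is then subtracted.
          below (suc j) = subtract-base (≤₁⇒≤bfo ≤₁-inl) (respects
            ( ≤₁-trans ⊕-interchange (≤₁-trans (⊕-mono ≤₁-refl (≤₁-Below-suc j))
                (≤₁-trans ⊕-interchange (⊕-mono ≤₁-refl U⊕∅≤U)))
            , ≤₁-trans (⊕-mono ⊕-comm ≤₁-refl) (≤₁-trans ⊕-assoc (≤₁-trans ⊕-comm
                (≤₁-trans (⊕-mono ≤₁-refl (Below-suc-≤₁ j)) ⊕-interchange))))
            (⊕-closed (below j)
              (absorbs _ (≤₁-trans (At-≤₁ j (IsManyOneReduction.reduces F)) U⊕∅≤U))))

-- Dyadic rationals and the order isomorphism

/-≤-/⇔ : ∀ m m′ d d′ .{{_ : NonZero d}} .{{_ : NonZero d′}} →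
         ℤ.+ m / d ℚ.≤ ℤ.+ m′ / d′ ⇔ m * d′ ≤ m′ * d
-- `_/_` cancels common factors, so the comparison is moved to the equivalent unnormalised
-- fractions, whose order is cross multiplication.
/-≤-/⇔ m m′ d@(suc e) d′@(suc e′) = mk⇔
  (λ le → ℤ.drop‿+≤+ (subst₂ ℤ._≤_ (sym (ℤ.pos-* m d′)) (sym (ℤ.pos-* m′ d))
    (ℚᵘ.drop-*≤* (ℚᵘ.≤-respˡ-≃ (ℚ.toℚᵘ-fromℚᵘ p)
      (ℚᵘ.≤-respʳ-≃ (ℚ.toℚᵘ-fromℚᵘ q) (ℚ.toℚᵘ-mono-≤ le))))))
  (λ le → ℚ.toℚᵘ-cancel-≤ (ℚᵘ.≤-respˡ-≃ (ℚᵘ.≃-sym (ℚ.toℚᵘ-fromℚᵘ p))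
    (ℚᵘ.≤-respʳ-≃ (ℚᵘ.≃-sym (ℚ.toℚᵘ-fromℚᵘ q))
    (*≤* (subst₂ ℤ._≤_ (ℤ.pos-* m d′) (ℤ.pos-* m′ d) (ℤ.+≤+ le))))))
  where
  p q : ℚᵘ
  p = mkℚᵘ (ℤ.+ m) e
  q = mkℚᵘ (ℤ.+ m′) e′

theorem4p6 : (P : Pairings) → let open Joins P in
    (U : ℕ → Pred ℕ 0ℓ) →
    WeakDyadicTower U →
    ¬ IsCylinder (U 0) →
    HasComputableReservoirs (U 0) →
    BaseAbsorption (U 0) U →
    (∀ B → B ≡bfo U 0 → IsAutojoinOfMember U B) ×
    (OneDegreesWithinBfo (U 0) ≅ 𝔻>0)
theorem4p6 P U tower ¬cylinder
  (_ , _ , (χ , χ-computable , χ-decides) , R₀-infinite , R₀⊆∁U) absorbs =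
  members , value , record
    { isOrderMonomorphism = record
      { isOrderHomomorphism = record
        { cong = λ {x} {y} (x≤y , y≤x) → ℚ.≤-antisym (mono x y x≤y) (mono y x y≤x)
        ; mono = λ {x} {y} → mono x y
        }
      ; injective = λ {x} {y} eq →
          cancel x y (ℚ.≤-reflexive eq) , cancel y x (ℚ.≤-reflexive (sym eq))
      ; cancel    = λ {x} {y} → cancel x y
      }
    ; surjective = surjective
    }
  where
  open Reductions P
  open Joins P
  open Tower U tower

  members : ∀ B → B ≡bfo U 0 → IsAutojoinOfMember U B
  members = classify ¬cylinder (Reservoir.⊕-∅-≤₁ χ χ-computable χ-decides R₀-infinite R₀⊆∁U) absorbs

  module 𝔹 = Poset (OneDegreesWithinBfo (U 0))
  module 𝔻 = Poset 𝔻>0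

  dyadic : ∀ {B} → IsAutojoinOfMember U B → 𝔻.Carrier
  dyadic (m , n , m≢0 , _) = _/_ (ℤ.+ m) (2 ^ n) {{m^n≢0 2 n}} , m , n , m≢0 , refl

  -- Both orders amount to comparing cross products. As the representations of A and B are
  -- arbitrary, the rational number depends only on the 1-degree, and order preservation and
  -- reflection follow together.
  dyadic-≤⇔ : ∀ {A B} (A∈ : IsAutojoinOfMember U A) (B∈ : IsAutojoinOfMember U B) →
              A ≤₁ B ⇔ dyadic A∈ 𝔻.≤ dyadic B∈
  dyadic-≤⇔ (m , n , m≢0 , A≤ , ≤A) (m′ , n′ , m′≢0 , B≤ , ≤B) =
    ⇔-sym (/-≤-/⇔ m m′ (2 ^ n) (2 ^ n′) {{m^n≢0 2 n}} {{m^n≢0 2 n′}}) ⇔-∘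
    (multiple-≤₁⇔ ¬cylinder m m′ m≢0 m′≢0 n n′ ⇔-∘
     mk⇔ (λ F → ≤₁-trans ≤A (≤₁-trans F B≤)) (λ F → ≤₁-trans A≤ (≤₁-trans F ≤B)))

  value : 𝔹.Carrier → 𝔻.Carrier
  value (B , B≡U) = dyadic (members B B≡U)

  mono : ∀ x y → x 𝔹.≤ y → value x 𝔻.≤ value y
  mono (A , A≡U) (B , B≡U) = Equivalence.to (dyadic-≤⇔ (members A A≡U) (members B B≡U))

  cancel : ∀ x y → value x 𝔻.≤ value y → x 𝔹.≤ y
  cancel (A , A≡U) (B , B≡U) = Equivalence.from (dyadic-≤⇔ (members A A≡U) (members B B≡U))

  surjective : ∀ d → ∃[ x ] ∀ {z} → z 𝔹.≈ x → value z 𝔻.≈ d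
  surjective (_ , m , n , m≢0 , refl) =
    (multiple m m≢0 n , multiple-≤bfo-base m m≢0 n , base-≤bfo-multiple m m≢0 n) ,
    -- `members` may pick another representation of the degree than m and n, so the two values are
    -- compared through `self`.
    λ { {C , C≡U} (C≤ , ≤C) → ℚ.≤-antisym
        (Equivalence.to (dyadic-≤⇔ (members C C≡U) self) C≤)
        (Equivalence.to (dyadic-≤⇔ self (members C C≡U)) ≤C) }
    where
    self : IsAutojoinOfMember U (multiple m m≢0 n)
    self = m , n , m≢0 , ≤₁-refl , ≤₁-refl
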